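{- Let $\delta$ be a positive integer. Let $Q^{(\delta)}_0(x)=1$ and $Q^{(\delta)}_{n+1}(x)=\delta x\,Q^{(\delta)}_n(x)+(1+x^2)\frac{d}{dx}Q^{(\delta)}_n(x)$ for $n\ge0$. Let $(T_n(x))_{n\ge\delta-1}$ be defined by $T_{\delta-1}(x)=1$ and, for $n\ge\delta-1$, $$T_{n+1}(x)=\Bigl(\tfrac{n-\delta+1}{\delta}x^2+x+1+\tfrac{n-\delta+1}{\delta}\Bigr)T_n(x)+\tfrac1\delta\bigl(-x^3+x^2-x+1\bigr)\frac{d}{dx}T_n(x).$$ Then: (i) for all $n\ge0$, $$Q^{(\delta)}_n(x)=\frac{\delta^n(1+x)^n}{2^n}\,T_{n+\delta-1}\!\left(\frac{x-1}{x+1}\right);$$ (ii) $$\sum_{n\ge0}Q^{(\delta)}_n(x)\frac{t^n}{n!}=\frac{1}{(\cos t-x\sin t)^{\delta}};$$ (iii) the ordinary generating function has the Jacobi continued fraction expansion $$\sum_{n=0}^\infty Q^{(\delta)}_n(x)t^n=\cfrac{1}{1-r_0t-\cfrac{s_1t^2}{1-r_1t-\cfrac{s_2t^2}{1-r_2t-\cdots}}},$$ where $r_i=(2i+\delta)x$ for $i\ge0$ and $s_i=i(i+\delta-1)(1+x^2)$ for $i\ge1$.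
   Context: Generating function identities are identities of formal power series in $t$. The $Q^{(\delta)}_n$ are the generalized derivative polynomials for secant: $\frac{d^n}{d\theta^n}\sec^\delta\theta=\sec^\delta\theta\cdot Q^{(\delta)}_n(\tan\theta)$. -}

module Defs where

open import Algebra.Bundles.Raw using (RawRing)
import Algebra.Definitions.RawSemiring as RawSemiringDefs
open import Data.Empty using (⊥-elim)
open import Data.Fin.Base using (toℕ)
open import Data.Integer.Base using (ℤ; +_)
import Data.Integer.Base as ℤ
open import Data.List.Base using (List; []; _∷_; map; drop)
open import Data.Nat.Base as ℕ using (ℕ; zero; suc; _≤_; _∸_; _!)
open import Data.Nat.Properties using (_!≢0)
open import Data.Product.Base using (∃-syntax)
open import Data.Rational.Base using (ℚ; 0ℚ; 1ℚ; _/_; _+_; _*_; -_)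
open import Data.Rational.Properties using (_≟_; *-zeroˡ; *-zeroʳ; +-identityˡ; +-identityʳ; *-assoc; *-inverseˡ; *-identityˡ)
import Data.Rational.Base as ℚ
open import Data.Sum.Base as Sum using (_⊎_; inj₁; inj₂)
open import Level using (0ℓ)
open import Relation.Binary.PropositionalEquality using (_≡_; _≢_; refl; sym; trans; cong)
open import Relation.Nullary using (¬_; yes; no)

-- Coefficient lists, lowest degree first.  Trailing zeros are allowed, so
-- equality of polynomials is _≈ₚ_, not _≡_.
Poly : Set
Poly = List ℚ

coeff : Poly → ℕ → ℚ
coeff []      _       = 0ℚ
coeff (a ∷ _) zero    = a
coeff (_ ∷ p) (suc k) = coeff p k

infix  4 _≈ₚ_
infixl 6 _+ₚ_
infixl 7 _*ₚ_
infix  8 -ₚ_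

_≈ₚ_ : Poly → Poly → Set
p ≈ₚ q = ∀ k → coeff p k ≡ coeff q k

0ₚ 1ₚ X : Poly
0ₚ = []
1ₚ = 1ℚ ∷ []
X  = 0ℚ ∷ 1ℚ ∷ []

const : ℚ → Poly
const a = a ∷ []

_+ₚ_ : Poly → Poly → Poly
[]      +ₚ q       = q
(a ∷ p) +ₚ []      = a ∷ p
(a ∷ p) +ₚ (b ∷ q) = (a + b) ∷ (p +ₚ q)

-ₚ_ : Poly → Poly
-ₚ_ = map (-_)

_*ₚ_ : Poly → Poly → Poly
[]      *ₚ q = []
(a ∷ p) *ₚ q = map (a *_) q +ₚ (0ℚ ∷ (p *ₚ q))

ℚ[x] : RawRing 0ℓ 0ℓ
ℚ[x] = record
  { Carrier = Poly ; _≈_ = _≈ₚ_ ; _+_ = _+ₚ_ ; _*_ = _*ₚ_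
  ; -_ = -ₚ_ ; 0# = 0ₚ ; 1# = 1ₚ }

open RawSemiringDefs (RawRing.rawSemiring ℚ[x]) public
  using () renaming (_^_ to infixr 8 _^ₚ_)

-- derivFrom k (a₀ ∷ a₁ ∷ …) = k a₀ ∷ (k+1) a₁ ∷ …
derivFrom : ℕ → Poly → Poly
derivFrom k []      = []
derivFrom k (a ∷ p) = ((+ k) / 1) * a ∷ derivFrom (suc k) p

deriv : Poly → Poly
deriv p = derivFrom 1 (drop 1 p)

coeff-+ₚ : ∀ p q k → coeff (p +ₚ q) k ≡ coeff p k + coeff q k
coeff-+ₚ []      q       k       = sym (+-identityˡ (coeff q k))
coeff-+ₚ (a ∷ p) []      k       = sym (+-identityʳ (coeff (a ∷ p) k))
coeff-+ₚ (a ∷ p) (b ∷ q) zero    = refl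
coeff-+ₚ (a ∷ p) (b ∷ q) (suc k) = coeff-+ₚ p q k

coeff-scale : ∀ a p k → coeff (map (a *_) p) k ≡ a * coeff p k
coeff-scale a []      k       = sym (*-zeroʳ a)
coeff-scale a (b ∷ p) zero    = refl
coeff-scale a (b ∷ p) (suc k) = coeff-scale a p k

coeff-∷* : ∀ a p q k →
  coeff ((a ∷ p) *ₚ q) k ≡ a * coeff q k + coeff (0ℚ ∷ (p *ₚ q)) k
coeff-∷* a p q k =
  trans (coeff-+ₚ (map (a *_) q) (0ℚ ∷ (p *ₚ q)) k)
        (cong (_+ coeff (0ℚ ∷ (p *ₚ q)) k) (coeff-scale a q k))

*-shiftʳ : ∀ p q → p *ₚ (0ℚ ∷ q) ≈ₚ 0ℚ ∷ (p *ₚ q)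
*-shiftʳ []      q zero    = refl
*-shiftʳ []      q (suc k) = refl
*-shiftʳ (a ∷ p) q zero    =
  trans (coeff-∷* a p (0ℚ ∷ q) zero) (trans (+-identityʳ (a * 0ℚ)) (*-zeroʳ a))
*-shiftʳ (a ∷ p) q (suc k) =
  trans (coeff-∷* a p (0ℚ ∷ q) (suc k))
        (trans (cong (_+_ (a * coeff q k)) (*-shiftʳ p q k))
               (sym (coeff-∷* a p q k)))

ℚ-domain : ∀ a b → a ≢ 0ℚ → a * b ≡ 0ℚ → b ≡ 0ℚ
ℚ-domain a b a≢0 ab≡0 =
  trans (sym (*-identityˡ b))
    (trans (cong (_* b) (sym (*-inverseˡ a)))
      (trans (*-assoc (ℚ.1/ a) a b)
        (trans (cong (ℚ.1/ a *_) ab≡0) (*-zeroʳ (ℚ.1/ a)))))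
  where instance _ = ℚ.≢-nonZero a≢0

∷-zero : ∀ {a p} → a ≡ 0ℚ → p ≈ₚ 0ₚ → a ∷ p ≈ₚ 0ₚ
∷-zero a≡0 p≈0 zero    = a≡0
∷-zero a≡0 p≈0 (suc k) = p≈0 k

unshiftˡ : ∀ {a} p q → a ≡ 0ℚ → (a ∷ p) *ₚ q ≈ₚ 0ₚ → p *ₚ q ≈ₚ 0ₚ
unshiftˡ p q refl h k =
  trans (sym (+-identityˡ (coeff (p *ₚ q) k)))
    (trans (cong (_+ coeff (p *ₚ q) k) (sym (*-zeroˡ (coeff q (suc k)))))
      (trans (sym (coeff-∷* 0ℚ p q (suc k))) (h (suc k))))

unshiftʳ : ∀ {b} p q → b ≡ 0ℚ → p *ₚ (b ∷ q) ≈ₚ 0ₚ → p *ₚ q ≈ₚ 0ₚ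
unshiftʳ p q refl h k = trans (sym (*-shiftʳ p q (suc k))) (h (suc k))

NoZeroDivisors : Poly → Poly → Set
NoZeroDivisors p q = p *ₚ q ≈ₚ 0ₚ → p ≈ₚ 0ₚ ⊎ q ≈ₚ 0ₚ

domain-step : ∀ a p b q → NoZeroDivisors p (b ∷ q) → NoZeroDivisors (a ∷ p) q →
  NoZeroDivisors (a ∷ p) (b ∷ q)
domain-step a p b q ihˡ ihʳ h with a ≟ 0ℚ | b ≟ 0ℚ
... | yes a≡0 | _       = Sum.map₁ (∷-zero a≡0) (ihˡ (unshiftˡ p (b ∷ q) a≡0 h))
... | no _    | yes b≡0 = Sum.map₂ (∷-zero b≡0) (ihʳ (unshiftʳ (a ∷ p) q b≡0 h))
... | no a≢0  | no b≢0  = ⊥-elim (b≢0 (ℚ-domain a b a≢0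
  (trans (sym (+-identityʳ (a * b)))
    (trans (sym (coeff-∷* a p (b ∷ q) zero)) (h zero)))))

-- Needed for products of denominators in ℚ(x) to be nonzero.
ℚ[x]-domain : ∀ p q → NoZeroDivisors p q
ℚ[x]-domain []      q       = λ _ → inj₁ (λ _ → refl)
ℚ[x]-domain (a ∷ p) []      = λ _ → inj₂ (λ _ → refl)
ℚ[x]-domain (a ∷ p) (b ∷ q) =
  domain-step a p b q (ℚ[x]-domain p (b ∷ q)) (ℚ[x]-domain (a ∷ p) q)

*ₚ-≉0 : ∀ p q → ¬ (p ≈ₚ 0ₚ) → ¬ (q ≈ₚ 0ₚ) → ¬ (p *ₚ q ≈ₚ 0ₚ)
*ₚ-≉0 p q p≉0 q≉0 pq≈0 with ℚ[x]-domain p q pq≈0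
... | inj₁ p≈0 = p≉0 p≈0
... | inj₂ q≈0 = q≉0 q≈0

record RatFun : Set where
  constructor frac
  field
    num   : Poly
    den   : Poly
    den≉0 : ¬ (den ≈ₚ 0ₚ)

1ₚ≉0 : ¬ (1ₚ ≈ₚ 0ₚ)
1ₚ≉0 eq with eq 0
... | ()

ι : Poly → RatFun
ι p = frac p 1ₚ 1ₚ≉0

infix  4 _≈ᵣ_
infixl 6 _+ᵣ_
infixl 7 _*ᵣ_
infix  8 -ᵣ_

_≈ᵣ_ : RatFun → RatFun → Set
frac p q _ ≈ᵣ frac p′ q′ _ = p *ₚ q′ ≈ₚ p′ *ₚ q

_+ᵣ_ _*ᵣ_ : RatFun → RatFun → RatFun
frac p q n +ᵣ frac p′ q′ n′ = frac (p *ₚ q′ +ₚ p′ *ₚ q) (q *ₚ q′) (*ₚ-≉0 q q′ n n′)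
frac p q n *ᵣ frac p′ q′ n′ = frac (p *ₚ p′) (q *ₚ q′) (*ₚ-≉0 q q′ n n′)

-ᵣ_ : RatFun → RatFun
-ᵣ frac p q n = frac (-ₚ p) q n

ℚ⟨x⟩ : RawRing 0ℓ 0ℓ
ℚ⟨x⟩ = record
  { Carrier = RatFun ; _≈_ = _≈ᵣ_ ; _+_ = _+ᵣ_ ; _*_ = _*ᵣ_
  ; -_ = -ᵣ_ ; 0# = ι 0ₚ ; 1# = ι 1ₚ }

eval : Poly → RatFun → RatFun
eval []      y = ι 0ₚ
eval (a ∷ p) y = ι (const a) +ᵣ y *ᵣ eval p y

X+1≉0 : ¬ (X +ₚ 1ₚ ≈ₚ 0ₚ)
X+1≉0 eq with eq 0
... | ()

[x-1]/[x+1] : RatFun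
[x-1]/[x+1] = frac (X +ₚ -ₚ 1ₚ) (X +ₚ 1ₚ) X+1≉0

module PowerSeries (R : RawRing 0ℓ 0ℓ) where

  open RawRing R renaming (_+_ to _⊕_; _*_ to _⊗_; -_ to ⊖_)
  open RawSemiringDefs rawSemiring using (sum)

  -- A series in the indeterminate t is its coefficient sequence.
  Series : Set
  Series = ℕ → Carrier

  infix  4 _≈ₛ_
  infixl 6 _+ₛ_ _-ₛ_
  infixl 7 _*ₛ_

  _≈ₛ_ : Series → Series → Set
  f ≈ₛ g = ∀ n → f n ≈ g n

  C : Carrier → Series
  C a zero    = a
  C a (suc _) = 0#

  t : Series
  t 1 = 1#
  t _ = 0#

  _+ₛ_ _-ₛ_ _*ₛ_ : Series → Series → Series
  (f +ₛ g) n = f n ⊕ g n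
  (f -ₛ g) n = f n ⊕ ⊖ g n
  (f *ₛ g) n = sum {suc n} (λ i → f (toℕ i) ⊗ g (n ∸ toℕ i))

  R[[t]] : RawRing 0ℓ 0ℓ
  R[[t]] = record
    { Carrier = Series ; _≈_ = _≈ₛ_ ; _+_ = _+ₛ_ ; _*_ = _*ₛ_
    ; -_ = λ f n → ⊖ f n ; 0# = C 0# ; 1# = C 1# }

  open RawSemiringDefs (RawRing.rawSemiring R[[t]]) public
    using () renaming (_^_ to infixr 8 _^ₛ_)

  -- The reciprocal of a series f with constant term 1, as the geometric
  -- series 1/f = Σₖ (1 - f)ᵏ.  Since (1 - f)ᵏ is divisible by tᵏ, only the
  -- terms k ≤ n contribute to the coefficient of tⁿ.  Not meaningful for
  -- other constant terms.
  recip : Series → Series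
  recip f n = sum {suc n} (λ k → ((C 1# -ₛ f) ^ₛ toℕ k) n)

  -- The N-th convergent of
  --   1 / (1 - r₀ t - s₁ t² / (1 - r₁ t - s₂ t² / (1 - r₂ t - ⋯))),
  -- which keeps r₀ … r_{N-1} and s₁ … s_{N-1}; s 0 is not used.
  convergent : (r s : ℕ → Carrier) → ℕ → Series
  convergent r s zero    = C 0#
  convergent r s (suc N) =
    recip (C 1# -ₛ C (r 0) *ₛ t
                -ₛ C (s 1) *ₛ t ^ₛ 2 *ₛ convergent (λ i → r (suc i)) (λ i → s (suc i)) N)

  -- Convergence of the convergents to f in the t-adic topology.
  IsJFraction : Series → (r s : ℕ → Carrier) → Set
  IsJFraction f r s = ∀ n → ∃[ N ] (∀ k → N ≤ k → convergent r s k n ≈ f n)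

open PowerSeries ℚ[x] public

1/_! : ℕ → ℚ
1/ n ! = ((+ 1) / (n !)) {{n !≢0}}

-- cosℤ n and sinℤ n are the n-th derivatives of cos and sin at 0.
cosℤ sinℤ : ℕ → ℤ
cosℤ 0             = + 1
cosℤ 1             = + 0
cosℤ (suc (suc n)) = ℤ.- cosℤ n
sinℤ 0             = + 0
sinℤ 1             = + 1
sinℤ (suc (suc n)) = ℤ.- sinℤ n

cos-t sin-t : Series
cos-t n = const (cosℤ n / 1 * 1/ n !)
sin-t n = const (sinℤ n / 1 * 1/ n !)

egf : (ℕ → Poly) → Series
egf a n = const (1/ n !) *ₚ a n

ogf : (ℕ → Poly) → Series
ogf a = a

Q : ℕ → ℕ → Poly
Q δ zero    = 1ₚ
Q δ (suc n) = const ((+ δ) / 1) *ₚ X *ₚ Q δ n +ₚ (1ₚ +ₚ X ^ₚ 2) *ₚ deriv (Q δ n)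

-- (T n) for n ≥ δ - 1 is the sequence defined by the recurrence; the values
-- T n with n < δ - 1 are unconstrained.
record IsT (δ : ℕ) .{{_ : ℕ.NonZero δ}} (T : ℕ → Poly) : Set where
  c : ℕ → ℚ
  c n = ((+ n) ℤ.- (+ δ) ℤ.+ (+ 1)) / δ

  field
    base : T (δ ∸ 1) ≈ₚ 1ₚ
    step : ∀ n → δ ∸ 1 ≤ n →
      T (suc n) ≈ₚ
        (const (c n) *ₚ X ^ₚ 2 +ₚ X +ₚ 1ₚ +ₚ const (c n)) *ₚ T n
        +ₚ const ((+ 1) / δ) *ₚ (-ₚ (X ^ₚ 3) +ₚ X ^ₚ 2 +ₚ -ₚ X +ₚ 1ₚ) *ₚ deriv (T n)

{-# OPTIONS --safe #-}

-- Each part is an algebraic shadow of the recurrence Q' = δ x Q + (1 + x²) dQ/dx.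
--
-- (i)   Under y = (x - 1)/(x + 1) one has 1 + y² = 2 (1 + x²)/(x + 1)², 1 + y = 2 x/(x + 1),
--       1 - y = 2/(x + 1) and dy/dx = 2/(x + 1)², which turns the recurrence of T into that
--       of Q.  Rational functions in x are handled by clearing powers of x + 1.
-- (ii)  For the derivation L = d/dt - (1 + x²) d/dx, both the generating function E of Q and
--       W = (cos t - x sin t)^δ are eigenvectors, of eigenvalues δ x and - δ x.  Hence
--       L (E W) = 0, and as E W is 1 at t = 0 this forces E W = 1.
-- (iii) Differentiating the recurrence k times gives, for b n k = (d/dx)^k (Q n),
--         b (n+1) k = k (k + δ - 1) b n (k-1) + (2 k + δ) x b n k + (1 + x²) b n (k+1),
--       a tridiagonal system whose coefficients are those of the continued fraction.  Each
--       level of the fraction contributes a factor t, so the N-th convergent agrees with the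
--       generating function of n ↦ b n 0 = Q n up to t^(N-1).
module Submission where

open import Defs hiding (Series; C; t; _≈ₛ_; _+ₛ_; _-ₛ_; _*ₛ_; R[[t]]; _^ₛ_; recip; convergent; IsJFraction)
open import Algebra.Bundles using (CommutativeRing)
open import Algebra.Bundles.Raw using (RawRing)
import Algebra.Definitions.RawSemiring as RawSemiringDefinitions
import Algebra.Morphism.RingMonomorphism as RingMonomorphism
open import Algebra.Morphism.Structures using (IsRingHomomorphism; IsRingMonomorphism)
import Algebra.Properties.Ring as RingProperties
import Algebra.Solver.Ring as RingSolver
open import Algebra.Solver.Ring.AlmostCommutativeRing using (fromCommutativeRing; _-Raw-AlmostCommutative⟶_)
open import Data.Fin.Base using (toℕ)
open import Data.Integer.Base as ℤ using (ℤ; +_)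
import Data.Integer.Properties as ℤ
import Data.Integer.Tactic.RingSolver as ℤ-Solver
open import Data.List.Base using ([]; _∷_; map; length)
open import Data.Maybe.Base using (Maybe; just; nothing)
open import Data.Nat.Base as ℕ using (ℕ; NonZero; zero; suc; z≤n; s≤s; _≤_; _<_; _!)
import Data.Nat.Properties as ℕ
open import Data.Nat.Tactic.RingSolver using (solve-∀)
open import Data.Product.Base using (_×_; _,_)
open import Data.Rational.Base as ℚ using (ℚ; 0ℚ; 1ℚ; _/_; toℚᵘ)
import Data.Rational.Properties as ℚ
open import Data.Rational.Unnormalised.Base as ℚᵘ using (mkℚᵘ; *≡*)
import Data.Rational.Unnormalised.Properties as ℚᵘ
open import Data.Sum.Base using (inj₁; inj₂)
open import Level using (0ℓ)
open import Relation.Binary.PropositionalEquality as ≡ using (_≡_)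
import Relation.Binary.Reasoning.Setoid as SetoidReasoning
open import Relation.Nullary using (yes; no; contradiction)


-- Arithmetic of rational numbers and factorials.

/1-homo-+ : ∀ i j → (i ℤ.+ j) / 1 ≡ i / 1 ℚ.+ j / 1
/1-homo-+ i j = ℚ.toℚᵘ-injective (begin
  toℚᵘ ((i ℤ.+ j) / 1)                ≈⟨ ℚ.toℚᵘ-fromℚᵘ (mkℚᵘ (i ℤ.+ j) 0) ⟩
  mkℚᵘ (i ℤ.+ j) 0                    ≈⟨ *≡* (≡.cong (ℤ._* + 1) (≡.cong₂ ℤ._+_ (≡.sym (ℤ.*-identityʳ i)) (≡.sym (ℤ.*-identityʳ j)))) ⟩
  mkℚᵘ i 0 ℚᵘ.+ mkℚᵘ j 0              ≈⟨ ℚᵘ.+-cong (ℚ.toℚᵘ-fromℚᵘ (mkℚᵘ i 0)) (ℚ.toℚᵘ-fromℚᵘ (mkℚᵘ j 0)) ⟨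
  toℚᵘ (i / 1) ℚᵘ.+ toℚᵘ (j / 1)      ≈⟨ ℚ.toℚᵘ-homo-+ (i / 1) (j / 1) ⟨
  toℚᵘ (i / 1 ℚ.+ j / 1)              ∎)
  where open SetoidReasoning ℚᵘ.≃-setoid

/1-homo-neg : ∀ i → (ℤ.- i) / 1 ≡ ℚ.- (i / 1)
/1-homo-neg (+ zero)   = ≡.refl
/1-homo-neg (+ suc n)  = ≡.refl
/1-homo-neg ℤ.-[1+ n ] = ≡.sym (RingProperties.-‿involutive ℚ.+-*-ring (+ suc n / 1))

-- Rationals are stored in lowest terms, so a product of fractions does not compute to the expected
-- one. Between unnormalised fractions, equality is the cross-multiplied integer equation, which is
-- the hypothesis here.
/-*-/ : ∀ i j k l m n .{{_ : NonZero l}} .{{_ : NonZero m}} .{{_ : NonZero n}} →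
  i ℤ.* j ℤ.* + n ≡ k ℤ.* + (l ℕ.* m) → (i / l) ℚ.* (j / m) ≡ k / n
/-*-/ i j k (suc l) (suc m) (suc n) eq = ℚ.toℚᵘ-injective (begin
  toℚᵘ ((i / suc l) ℚ.* (j / suc m))         ≈⟨ ℚ.toℚᵘ-homo-* (i / suc l) (j / suc m) ⟩
  toℚᵘ (i / suc l) ℚᵘ.* toℚᵘ (j / suc m)     ≈⟨ ℚᵘ.*-cong (ℚ.toℚᵘ-fromℚᵘ (mkℚᵘ i l)) (ℚ.toℚᵘ-fromℚᵘ (mkℚᵘ j m)) ⟩
  mkℚᵘ i l ℚᵘ.* mkℚᵘ j m                     ≈⟨ *≡* eq ⟩
  mkℚᵘ k n                                   ≈⟨ ℚ.toℚᵘ-fromℚᵘ (mkℚᵘ k n) ⟨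
  toℚᵘ (k / suc n)                           ∎)
  where open SetoidReasoning ℚᵘ.≃-setoid

+/-*-/ : ∀ a b c l m n .{{_ : NonZero l}} .{{_ : NonZero m}} .{{_ : NonZero n}} →
  a ℕ.* b ℕ.* n ≡ c ℕ.* (l ℕ.* m) → (+ a / l) ℚ.* (+ b / m) ≡ + c / n
+/-*-/ a b c l m n eq = /-*-/ (+ a) (+ b) (+ c) l m n
  (≡.trans (≡.cong (ℤ._* + n) (≡.sym (ℤ.pos-* a b)))
  (≡.trans (≡.sym (ℤ.pos-* (a ℕ.* b) n)) (≡.trans (≡.cong +_ eq) (ℤ.pos-* c (l ℕ.* m)))))

ν : ℕ → ℚ
ν n = + n / 1

ν-suc : ∀ n → ν (suc n) ≡ 1ℚ ℚ.+ ν n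
ν-suc n = /1-homo-+ (+ 1) (+ n)

ν-inverse : ∀ n → ν (suc n) ℚ.* (+ 1 / suc n) ≡ 1ℚ
ν-inverse n = +/-*-/ (suc n) 1 1 1 (suc n) 1
  (≡.trans (≡.cong (ℕ._* 1) (ℕ.*-identityʳ (suc n))) (≡.trans (ℕ.*-identityʳ (suc n)) (≡.sym (≡.trans (ℕ.*-identityˡ (1 ℕ.* suc n)) (ℕ.*-identityˡ (suc n))))))

-- This is why differentiation in t shifts the index of an exponential generating function.
ν-*-1/! : ∀ n → ν (suc n) ℚ.* (1/ suc n !) ≡ 1/ n !
ν-*-1/! n = +/-*-/ (suc n) 1 1 1 (suc n !) (n !) {{_}} {{suc n ℕ.!≢0}} {{n ℕ.!≢0}}
  (begin
    suc n ℕ.* 1 ℕ.* n !       ≡⟨ ≡.cong (ℕ._* n !) (ℕ.*-identityʳ (suc n)) ⟩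
    suc n !                   ≡⟨ ℕ.*-identityˡ (suc n !) ⟨
    1 ℕ.* suc n !             ≡⟨ ℕ.*-identityˡ (1 ℕ.* suc n !) ⟨
    1 ℕ.* (1 ℕ.* suc n !)     ∎)
  where open ≡.≡-Reasoning

ν-*-/! : ∀ a n → ν (suc n) ℚ.* (a ℚ.* 1/ suc n !) ≡ a ℚ.* 1/ n !
ν-*-/! a n = begin
  ν (suc n) ℚ.* (a ℚ.* 1/ suc n !)  ≡⟨ ℚ.*-assoc (ν (suc n)) a (1/ suc n !) ⟨
  ν (suc n) ℚ.* a ℚ.* 1/ suc n !    ≡⟨ ≡.cong (ℚ._* 1/ suc n !) (ℚ.*-comm (ν (suc n)) a) ⟩
  a ℚ.* ν (suc n) ℚ.* 1/ suc n !    ≡⟨ ℚ.*-assoc a (ν (suc n)) (1/ suc n !) ⟩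
  a ℚ.* (ν (suc n) ℚ.* 1/ suc n !)  ≡⟨ ≡.cong (a ℚ.*_) (ν-*-1/! n) ⟩
  a ℚ.* 1/ n !                      ∎
  where open ≡.≡-Reasoning

-- `sinℤ` and `cosℤ` recurse with step two, whereas differentiating the sine and cosine series moves
-- the index by one.
sinℤ-suc : ∀ n → sinℤ (suc n) ≡ cosℤ n
sinℤ-suc 0             = ≡.refl
sinℤ-suc 1             = ≡.refl
sinℤ-suc (suc (suc n)) = ≡.cong ℤ.-_ (sinℤ-suc n)

cosℤ-suc : ∀ n → cosℤ (suc n) ≡ ℤ.- sinℤ n
cosℤ-suc 0             = ≡.refl
cosℤ-suc 1             = ≡.refl
cosℤ-suc (suc (suc n)) = ≡.cong ℤ.-_ (cosℤ-suc n)

-- Algebras over ℚ and their derivations.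

record ℚ-Algebra : Set₁ where
  field
    commutativeRing : CommutativeRing 0ℓ 0ℓ
  open CommutativeRing commutativeRing public
  field
    φ                : ℚ → Carrier
    φ-isHomomorphism : IsRingHomomorphism ℚ.+-*-rawRing rawRing φ
  module φ = IsRingHomomorphism φ-isHomomorphism

  -- Coincides with φ up to ≈, but sends 0ℚ and 1ℚ to 0# and 1# definitionally,
  -- so that the ring solver recognises these constants.
  ⟦_⟧ℚ : ℚ → Carrier
  ⟦ q ⟧ℚ with q ℚ.≟ 0ℚ | q ℚ.≟ 1ℚ
  ... | yes _ | _     = 0#
  ... | no _  | yes _ = 1#
  ... | no _  | no _  = φ q

  ⟦⟧≈φ : ∀ q → ⟦ q ⟧ℚ ≈ φ q
  ⟦⟧≈φ q with q ℚ.≟ 0ℚ | q ℚ.≟ 1ℚ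
  ... | yes q≡0 | _       = trans (sym φ.0#-homo) (reflexive (≡.cong φ (≡.sym q≡0)))
  ... | no _    | yes q≡1 = trans (sym φ.1#-homo) (reflexive (≡.cong φ (≡.sym q≡1)))
  ... | no _    | no _    = refl

  ⟦⟧-≟ : ∀ p q → Maybe (⟦ p ⟧ℚ ≈ ⟦ q ⟧ℚ)
  ⟦⟧-≟ p q with p ℚ.≟ q
  ... | yes p≡q = just (reflexive (≡.cong ⟦_⟧ℚ p≡q))
  ... | no _    = nothing

  ⟦⟧-morphism : ℚ.+-*-rawRing -Raw-AlmostCommutative⟶ fromCommutativeRing commutativeRing
  ⟦⟧-morphism = record
    { ⟦_⟧    = ⟦_⟧ℚ
    ; +-homo = λ p q → trans (⟦⟧≈φ (p ℚ.+ q)) (trans (φ.+-homo p q) (sym (+-cong (⟦⟧≈φ p) (⟦⟧≈φ q))))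
    ; *-homo = λ p q → trans (⟦⟧≈φ (p ℚ.* q)) (trans (φ.*-homo p q) (sym (*-cong (⟦⟧≈φ p) (⟦⟧≈φ q))))
    ; -‿homo = λ p → trans (⟦⟧≈φ (ℚ.- p)) (trans (φ.-‿homo p) (sym (-‿cong (⟦⟧≈φ p))))
    ; 0-homo = refl
    ; 1-homo = refl
    }

  module Solver = RingSolver ℚ.+-*-rawRing (fromCommutativeRing commutativeRing) ⟦⟧-morphism ⟦⟧-≟

  φν-suc : ∀ n → φ (ν (suc n)) ≈ 1# + φ (ν n)
  φν-suc n = trans (reflexive (≡.cong φ (ν-suc n))) (trans (φ.+-homo 1ℚ (ν n)) (+-congʳ φ.1#-homo))

record Derivation (A : CommutativeRing 0ℓ 0ℓ) : Set where
  open CommutativeRing A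
  field
    D       : Carrier → Carrier
    D-cong  : ∀ {f g} → f ≈ g → D f ≈ D g
    D-+     : ∀ f g → D (f + g) ≈ D f + D g
    D-neg   : ∀ f → D (- f) ≈ - D f
    leibniz : ∀ f g → D (f * g) ≈ D f * g + f * D g

-- Formal power series

module SeriesRing (A : CommutativeRing 0ℓ 0ℓ) where
  open CommutativeRing A
  open PowerSeries rawRing
  open RingProperties ring using (-0#≈0#)
  open SetoidReasoning setoid

  -- `(f *ₛ g) (suc n)` unfolds definitionally to `f 0 * g (suc n) + (tail f *ₛ g) n`. The
  -- inductions on products below rest on this.
  tail : Series → Series
  tail f n = f (suc n)

  -- Coefficient `n` of a product involves no coefficient beyond `n`. The bounded form serves series
  -- that are known to agree only up to some order.
  *ₛ-cong-≤ : ∀ f f′ g g′ n → (∀ {k} → k ≤ n → f k ≈ f′ k) → (∀ {k} → k ≤ n → g k ≈ g′ k) →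
    (f *ₛ g) n ≈ (f′ *ₛ g′) n
  *ₛ-cong-≤ f f′ g g′ zero    p q = +-congʳ (*-cong (p z≤n) (q z≤n))
  *ₛ-cong-≤ f f′ g g′ (suc n) p q = +-cong (*-cong (p z≤n) (q ℕ.≤-refl))
    (*ₛ-cong-≤ (tail f) (tail f′) g g′ n (λ k≤n → p (s≤s k≤n)) (λ k≤n → q (ℕ.m≤n⇒m≤1+n k≤n)))

  *ₛ-cong : ∀ {f f′ g g′} → f ≈ₛ f′ → g ≈ₛ g′ → (f *ₛ g) ≈ₛ (f′ *ₛ g′)
  *ₛ-cong {f} {f′} {g} {g′} p q n = *ₛ-cong-≤ f f′ g g′ n (λ {k} _ → p k) (λ {k} _ → q k)

  *ₛ-zeroˡ : ∀ f g → (∀ n → f n ≈ 0#) → ∀ n → (f *ₛ g) n ≈ 0#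
  *ₛ-zeroˡ f g f≈0 zero    = trans (+-identityʳ _) (trans (*-congʳ (f≈0 0)) (zeroˡ _))
  *ₛ-zeroˡ f g f≈0 (suc n) = trans (+-cong (trans (*-congʳ (f≈0 0)) (zeroˡ _)) (*ₛ-zeroˡ (tail f) g (λ k → f≈0 (suc k)) n)) (+-identityʳ 0#)

  *ₛ-scaleˡ : ∀ a f g n → ((λ k → a * f k) *ₛ g) n ≈ a * (f *ₛ g) n
  *ₛ-scaleˡ a f g zero    = trans (+-identityʳ _) (trans (*-assoc a (f 0) (g 0)) (*-congˡ (sym (+-identityʳ _))))
  *ₛ-scaleˡ a f g (suc n) = begin
    a * f 0 * g (suc n) + ((λ k → a * tail f k) *ₛ g) n  ≈⟨ +-cong (*-assoc a (f 0) (g (suc n))) (*ₛ-scaleˡ a (tail f) g n) ⟩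
    a * (f 0 * g (suc n)) + a * (tail f *ₛ g) n          ≈⟨ distribˡ a _ _ ⟨
    a * (f 0 * g (suc n) + (tail f *ₛ g) n)              ∎

  C-*ₛ : ∀ a f n → (C a *ₛ f) n ≈ a * f n
  C-*ₛ a f zero    = +-identityʳ (a * f 0)
  C-*ₛ a f (suc n) = trans (+-congˡ (*ₛ-zeroˡ (tail (C a)) f (λ _ → refl) n)) (+-identityʳ _)

  *ₛ-identityˡ : ∀ f n → (C 1# *ₛ f) n ≈ f n
  *ₛ-identityˡ f n = trans (C-*ₛ 1# f n) (*-identityˡ (f n))

  *ₛ-distribʳ : ∀ h f g n → ((f +ₛ g) *ₛ h) n ≈ (f *ₛ h) n + (g *ₛ h) n
  *ₛ-distribʳ h f g zero    = begin
    (f 0 + g 0) * h 0 + 0#                  ≈⟨ +-identityʳ _ ⟩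
    (f 0 + g 0) * h 0                       ≈⟨ distribʳ (h 0) (f 0) (g 0) ⟩
    f 0 * h 0 + g 0 * h 0                   ≈⟨ +-cong (+-identityʳ _) (+-identityʳ _) ⟨
    (f 0 * h 0 + 0#) + (g 0 * h 0 + 0#)     ∎
  *ₛ-distribʳ h f g (suc n) = begin
    (f 0 + g 0) * h (suc n) + ((tail f +ₛ tail g) *ₛ h) n
      ≈⟨ +-cong (distribʳ (h (suc n)) (f 0) (g 0)) (*ₛ-distribʳ h (tail f) (tail g) n) ⟩
    (f 0 * h (suc n) + g 0 * h (suc n)) + ((tail f *ₛ h) n + (tail g *ₛ h) n)
      ≈⟨ medial _ _ _ _ ⟩
    (f 0 * h (suc n) + (tail f *ₛ h) n) + (g 0 * h (suc n) + (tail g *ₛ h) n) ∎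
    where open import Algebra.Properties.CommutativeSemigroup +-commutativeSemigroup using () renaming (interchange to medial)

  -- The product unfolds at its left factor only; splitting off the last term instead is the mirror
  -- image that commutativity requires.
  *ₛ-sucʳ : ∀ f g n → (f *ₛ g) (suc n) ≈ f (suc n) * g 0 + (f *ₛ tail g) n
  *ₛ-sucʳ f g zero    = begin
    f 0 * g 1 + (f 1 * g 0 + 0#)  ≈⟨ +-congˡ (+-identityʳ _) ⟩
    f 0 * g 1 + f 1 * g 0         ≈⟨ +-comm _ _ ⟩
    f 1 * g 0 + f 0 * g 1         ≈⟨ +-congˡ (+-identityʳ _) ⟨
    f 1 * g 0 + (f 0 * g 1 + 0#)  ∎
  *ₛ-sucʳ f g (suc n) = begin
    f 0 * g (suc (suc n)) + (tail f *ₛ g) (suc n)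
      ≈⟨ +-congˡ (*ₛ-sucʳ (tail f) g n) ⟩
    f 0 * g (suc (suc n)) + (f (suc (suc n)) * g 0 + (tail f *ₛ tail g) n)
      ≈⟨ x∙yz≈y∙xz _ _ _ ⟩
    f (suc (suc n)) * g 0 + (f 0 * g (suc (suc n)) + (tail f *ₛ tail g) n) ∎
    where open import Algebra.Properties.CommutativeSemigroup +-commutativeSemigroup using (x∙yz≈y∙xz)

  *ₛ-comm : ∀ f g n → (f *ₛ g) n ≈ (g *ₛ f) n
  *ₛ-comm f g zero    = +-congʳ (*-comm (f 0) (g 0))
  *ₛ-comm f g (suc n) = begin
    f 0 * g (suc n) + (tail f *ₛ g) n  ≈⟨ +-cong (*-comm (f 0) (g (suc n))) (*ₛ-comm (tail f) g n) ⟩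
    g (suc n) * f 0 + (g *ₛ tail f) n  ≈⟨ *ₛ-sucʳ g f n ⟨
    (g *ₛ f) (suc n)                   ∎

  *ₛ-assoc : ∀ f g h n → ((f *ₛ g) *ₛ h) n ≈ (f *ₛ (g *ₛ h)) n
  *ₛ-assoc f g h zero    = +-congʳ (begin
    (f 0 * g 0 + 0#) * h 0    ≈⟨ *-congʳ (+-identityʳ _) ⟩
    f 0 * g 0 * h 0           ≈⟨ *-assoc (f 0) (g 0) (h 0) ⟩
    f 0 * (g 0 * h 0)         ≈⟨ *-congˡ (+-identityʳ _) ⟨
    f 0 * (g 0 * h 0 + 0#)    ∎)
  *ₛ-assoc f g h (suc n) = begin
    (f 0 * g 0 + 0#) * h (suc n) + (((λ k → f 0 * tail g k) +ₛ (tail f *ₛ g)) *ₛ h) n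
      ≈⟨ +-cong (trans (*-congʳ (+-identityʳ _)) (*-assoc (f 0) (g 0) (h (suc n)))) (*ₛ-distribʳ h (λ k → f 0 * tail g k) (tail f *ₛ g) n) ⟩
    f 0 * (g 0 * h (suc n)) + (((λ k → f 0 * tail g k) *ₛ h) n + ((tail f *ₛ g) *ₛ h) n)
      ≈⟨ +-congˡ (+-cong (*ₛ-scaleˡ (f 0) (tail g) h n) (*ₛ-assoc (tail f) g h n)) ⟩
    f 0 * (g 0 * h (suc n)) + (f 0 * (tail g *ₛ h) n + (tail f *ₛ (g *ₛ h)) n)
      ≈⟨ +-assoc _ _ _ ⟨
    f 0 * (g 0 * h (suc n)) + f 0 * (tail g *ₛ h) n + (tail f *ₛ (g *ₛ h)) n
      ≈⟨ +-congʳ (distribˡ (f 0) _ _) ⟨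
    f 0 * (g *ₛ h) (suc n) + (tail f *ₛ (g *ₛ h)) n ∎

  C-cong : ∀ {a b} → a ≈ b → C a ≈ₛ C b
  C-cong a≈b zero    = a≈b
  C-cong a≈b (suc n) = refl

  C-+ : ∀ a b → C (a + b) ≈ₛ (C a +ₛ C b)
  C-+ a b zero    = refl
  C-+ a b (suc n) = sym (+-identityʳ 0#)

  C-neg : ∀ a → C (- a) ≈ₛ (λ n → - C a n)
  C-neg a zero    = refl
  C-neg a (suc n) = sym -0#≈0#

  C-* : ∀ a b → C (a * b) ≈ₛ (C a *ₛ C b)
  C-* a b zero    = sym (C-*ₛ a (C b) 0)
  C-* a b (suc n) = sym (trans (C-*ₛ a (C b) (suc n)) (zeroʳ a))

  C-0# : ∀ n → C 0# n ≈ 0#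
  C-0# zero    = refl
  C-0# (suc n) = refl

  seriesRing : CommutativeRing 0ℓ 0ℓ
  seriesRing = record
    { Carrier = Series ; _≈_ = _≈ₛ_ ; _+_ = _+ₛ_ ; _*_ = _*ₛ_
    ; -_ = λ f n → - f n ; 0# = C 0# ; 1# = C 1#
    ; isCommutativeRing = record
      { isRing = record
        { +-isAbelianGroup = record
          { isGroup = record
            { isMonoid = record
              { isSemigroup = record
                { isMagma = record
                  { isEquivalence = record
                    { refl = λ _ → refl ; sym = λ p n → sym (p n) ; trans = λ p q n → trans (p n) (q n) }
                  ; ∙-cong = λ p q n → +-cong (p n) (q n)
                  }
                ; assoc = λ f g h n → +-assoc (f n) (g n) (h n)
                }
              ; identity = (λ f n → trans (+-congʳ (C-0# n)) (+-identityˡ (f n)))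
                         , (λ f n → trans (+-congˡ (C-0# n)) (+-identityʳ (f n)))
              }
            ; inverse = (λ f n → trans (-‿inverseˡ (f n)) (sym (C-0# n)))
                      , (λ f n → trans (-‿inverseʳ (f n)) (sym (C-0# n)))
            ; ⁻¹-cong = λ p n → -‿cong (p n)
            }
          ; comm = λ f g n → +-comm (f n) (g n)
          }
        ; *-cong = *ₛ-cong
        ; *-assoc = *ₛ-assoc
        ; *-identity = *ₛ-identityˡ , λ f n → trans (*ₛ-comm f (C 1#) n) (*ₛ-identityˡ f n)
        ; distrib = (λ h f g n → trans (*ₛ-comm h (f +ₛ g) n)
                      (trans (*ₛ-distribʳ h f g n) (+-cong (*ₛ-comm f h n) (*ₛ-comm g h n))))
                  , *ₛ-distribʳ
        }
      ; *-comm = *ₛ-comm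
      }
    }

-- Solved over an abstract algebra, so that the solver does not unfold the operations
-- of the series and polynomial rings to which these identities are applied.
module Identities (A : ℚ-Algebra) where
  open ℚ-Algebra A
  open RawSemiringDefinitions (RawRing.rawSemiring rawRing) using (_^_)
  open Solver

  -- One factor of `t ^ 2` stays with `w`, the other joins `u` and `a`. The product `u * t * a` so
  -- formed is the left-hand side of the next level of the fraction.
  jfraction-denominator : ∀ r s u w t c a → s ≈ u * w →
    (1# - r * t - s * t ^ 2 * c) * a ≈ a - r * t * a - w * t * (c * (u * t * a))
  jfraction-denominator r s u w t c a s≈uw =
    trans (*-congʳ (+-congˡ (-‿cong (*-congʳ (*-congʳ s≈uw)))))
      (solve 6 (λ r u w t c a →
        (con 1ℚ :- r :* t :- u :* w :* t :^ 2 :* c) :* a := a :- r :* t :* a :- w :* t :* (c :* (u :* t :* a)))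
        refl r u w t c a)

  inverse-from-fixpoint : ∀ f h → h ≈ 1# + (1# - f) * h → f * h ≈ 1#
  inverse-from-fixpoint f h h≈ = trans
    (solve 2 (λ f h → f :* h := h :- (con 1ℚ :- f) :* h) refl f h)
    (trans (+-congʳ h≈) (solve 1 (λ y → con 1ℚ :+ y :- y := con 1ℚ) refl ((1# - f) * h)))

  inverse-unique : ∀ f h h′ → f * h ≈ 1# → f * h′ ≈ 1# → h ≈ h′
  inverse-unique f h h′ fh≈1 fh′≈1 = trans (sym (*-identityˡ h)) (trans (*-congʳ (sym fh′≈1))
    (trans (solve 3 (λ f h h′ → f :* h′ :* h := h′ :* (f :* h)) refl f h h′)
      (trans (*-congˡ fh≈1) (*-identityʳ h′))))

  rotation : ∀ c s x → - s - x * c - (1# + x ^ 2) * (- s) ≈ - x * (c - x * s)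
  rotation = solve 3 (λ c s x → :- s :- x :* c :- (con 1ℚ :+ x :^ 2) :* (:- s) := :- x :* (c :- x :* s)) refl

  cancel-eigenvalues : ∀ d x f → (d * (- x) + d * x) * f ≈ 0#
  cancel-eigenvalues = solve 3 (λ d x f → (d :* (:- x) :+ d :* x) :* f := con 0ℚ) refl

  T-step-expand : ∀ c e x p p′ →
    (c * x ^ 2 + x + 1# + c) * p + e * (- (x ^ 3) + x ^ 2 + - x + 1#) * p′ ≈
    c * (x * (x * p)) + x * p + p + c * p
    + e * (φ (ℚ.- 1ℚ) * (x * (x * (x * p′))) + x * (x * p′) + φ (ℚ.- 1ℚ) * (x * p′) + p′)
  T-step-expand = solve 5 (λ c e x p p′ →
    (c :* x :^ 2 :+ x :+ con 1ℚ :+ c) :* p :+ e :* (:- (x :^ 3) :+ x :^ 2 :+ :- x :+ con 1ℚ) :* p′ :=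
    c :* (x :* (x :* p)) :+ x :* p :+ p :+ c :* p
    :+ e :* (con (ℚ.- 1ℚ) :* (x :* (x :* (x :* p′))) :+ x :* (x :* p′) :+ con (ℚ.- 1ℚ) :* (x :* p′) :+ p′)) refl

module SeriesAlgebra (A : ℚ-Algebra) where
  open ℚ-Algebra A
  open PowerSeries rawRing
  open SeriesRing commutativeRing public
  open SetoidReasoning setoid
  private module S = CommutativeRing seriesRing

  seriesAlgebra : ℚ-Algebra
  seriesAlgebra = record
    { commutativeRing  = seriesRing
    ; φ                = λ q → C (φ q)
    ; φ-isHomomorphism = record
      { isSemiringHomomorphism = record
        { isNearSemiringHomomorphism = record
          { +-isMonoidHomomorphism = record
            { isMagmaHomomorphism = record
              { isRelHomomorphism = record { cong = λ p → C-cong (φ.⟦⟧-cong p) }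
              ; homo = λ p q → S.trans {C (φ (p ℚ.+ q))} {C (φ p + φ q)} {C (φ p) +ₛ C (φ q)} (C-cong (φ.+-homo p q)) (C-+ (φ p) (φ q))
              }
            ; ε-homo = C-cong φ.0#-homo
            }
          ; *-homo = λ p q → S.trans {C (φ (p ℚ.* q))} {C (φ p * φ q)} {C (φ p) *ₛ C (φ q)} (C-cong (φ.*-homo p q)) (C-* (φ p) (φ q))
          }
        ; 1#-homo = C-cong φ.1#-homo
        }
      ; -‿homo = λ p → S.trans {C (φ (ℚ.- p))} {C (- φ p)} {λ n → - C (φ p) n} (C-cong (φ.-‿homo p)) (C-neg (φ p))
      }
    }

  private module I = Identities seriesAlgebra

  ∂ₜ : Series → Series
  ∂ₜ f n = φ (ν (suc n)) * f (suc n)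

  -- Induction on the index, with the weight `n + 2` split as `1 + (n + 1)`. The part `n + 1` is the
  -- weight in the induction hypothesis for `tail f` and `g`; the part `1` accounts for `tail (∂ₜ f)
  -- = ∂ₜ (tail f) + tail (tail f)`.
  ∂ₜ-leibniz : ∀ f g n → ∂ₜ (f *ₛ g) n ≈ (∂ₜ f *ₛ g) n + (f *ₛ ∂ₜ g) n
  ∂ₜ-leibniz f g zero    = solve 5 (λ s f₀ f₁ g₀ g₁ →
    s :* (f₀ :* g₁ :+ (f₁ :* g₀ :+ con 0ℚ)) := (s :* f₁ :* g₀ :+ con 0ℚ) :+ (f₀ :* (s :* g₁) :+ con 0ℚ))
    refl (φ (ν 1)) (f 0) (f 1) (g 0) (g 1)
    where open Solver
  ∂ₜ-leibniz f g (suc n) = begin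
    φ (ν (2 ℕ.+ n)) * (f 0 * g (2 ℕ.+ n) + fg)
      ≈⟨ *-congʳ (φν-suc (suc n)) ⟩
    (1# + s) * (f 0 * g (2 ℕ.+ n) + fg)
      ≈⟨ solve 4 (λ s a b fg → (con 1ℚ :+ s) :* (a :* b :+ fg) := a :* ((con 1ℚ :+ s) :* b) :+ fg :+ s :* fg) refl s (f 0) (g (2 ℕ.+ n)) fg ⟩
    f 0 * ((1# + s) * g (2 ℕ.+ n)) + fg + s * fg
      ≈⟨ +-cong (+-congʳ (*-congˡ (*-congʳ (φν-suc (suc n))))) (sym (∂ₜ-leibniz (tail f) g n)) ⟨
    f 0 * ∂ₜ g (suc n) + (f 1 * g (suc n) + u) + (p + q)
      ≈⟨ solve 6 (λ a b c u p q → a :+ (b :* c :+ u) :+ (p :+ q) := con 1ℚ :* b :* c :+ (p :+ u) :+ (a :+ q)) refl (f 0 * ∂ₜ g (suc n)) (f 1) (g (suc n)) u p q ⟩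
    1# * f 1 * g (suc n) + (p + u) + (f 0 * ∂ₜ g (suc n) + q)
      ≈⟨ +-congʳ (+-cong (*-congʳ (*-congʳ (sym φ.1#-homo))) (sym tail-∂ₜ)) ⟩
    ∂ₜ f 0 * g (suc n) + (tail (∂ₜ f) *ₛ g) n + (f 0 * ∂ₜ g (suc n) + q) ∎
    where
    open Solver
    s  = φ (ν (suc n))
    fg = (tail f *ₛ g) (suc n)
    u  = (tail (tail f) *ₛ g) n
    p  = (∂ₜ (tail f) *ₛ g) n
    q  = (tail f *ₛ ∂ₜ g) n
    tail-∂ₜ : (tail (∂ₜ f) *ₛ g) n ≈ p + u
    tail-∂ₜ = trans
      (*ₛ-cong {g = g} (λ k → trans (*-congʳ (φν-suc (suc k)))
        (solve 2 (λ a b → (con 1ℚ :+ a) :* b := a :* b :+ b) refl (φ (ν (suc k))) (f (2 ℕ.+ k)))) (λ _ → refl) n)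
      (*ₛ-distribʳ g (∂ₜ (tail f)) (tail (tail f)) n)

  ∂ₜ-derivation : Derivation seriesRing
  ∂ₜ-derivation = record
    { D       = ∂ₜ
    ; D-cong  = λ p n → *-congˡ (p (suc n))
    ; D-+     = λ f g n → distribˡ (φ (ν (suc n))) (f (suc n)) (g (suc n))
    ; D-neg   = λ f n → sym (-‿distribʳ-* (φ (ν (suc n))) (f (suc n)))
    ; leibniz = ∂ₜ-leibniz
    }
    where open RingProperties ring using (-‿distribʳ-*)

  t-*ₛ-suc : ∀ f n → (t *ₛ f) (suc n) ≈ f n
  t-*ₛ-suc f n = begin
    0# * f (suc n) + (tail t *ₛ f) n  ≈⟨ +-cong (zeroˡ (f (suc n))) (*ₛ-cong {g = f} tail-t (λ _ → refl) n) ⟩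
    0# + (C 1# *ₛ f) n                ≈⟨ trans (+-identityˡ _) (*ₛ-identityˡ f n) ⟩
    f n                               ∎
    where
    tail-t : tail t ≈ₛ C 1#
    tail-t zero    = refl
    tail-t (suc _) = refl

  C-t-*ₛ-zero : ∀ a f → (C a *ₛ t *ₛ f) 0 ≈ 0#
  C-t-*ₛ-zero a f = trans (+-identityʳ _) (trans (*-congʳ (trans (+-identityʳ _) (zeroʳ a))) (zeroˡ (f 0)))

  C-t-*ₛ-suc : ∀ a f n → (C a *ₛ t *ₛ f) (suc n) ≈ a * f n
  C-t-*ₛ-suc a f n = begin
    (C a *ₛ t *ₛ f) (suc n)    ≈⟨ *ₛ-assoc (C a) t f (suc n) ⟩
    (C a *ₛ (t *ₛ f)) (suc n)  ≈⟨ C-*ₛ a (t *ₛ f) (suc n) ⟩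
    a * (t *ₛ f) (suc n)       ≈⟨ *-congˡ (t-*ₛ-suc f n) ⟩
    a * f n                    ∎

  -- Multiplication by a series divisible by t gains one order of t-adic precision. Both the
  -- geometric series and the continued fraction converge for this reason.
  *ₛ-contraction : ∀ g f f′ n → g 0 ≈ 0# → (∀ {m} → m < n → f m ≈ f′ m) → (g *ₛ f) n ≈ (g *ₛ f′) n
  *ₛ-contraction g f f′ zero    g₀≈0 p = +-congʳ (trans (*-congʳ g₀≈0) (trans (zeroˡ (f 0)) (sym (trans (*-congʳ g₀≈0) (zeroˡ (f′ 0))))))
  *ₛ-contraction g f f′ (suc n) g₀≈0 p = +-cong
    (trans (*-congʳ g₀≈0) (trans (zeroˡ _) (sym (trans (*-congʳ g₀≈0) (zeroˡ _)))))
    (*ₛ-cong-≤ (tail g) (tail g) f f′ n (λ _ → refl) (λ k≤n → p (s≤s k≤n)))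

  open RawSemiringDefinitions (RawRing.rawSemiring rawRing) using (sum)

  sum-*ₛ : ∀ N g (h : ℕ → Series) m →
    sum {N} (λ k → (g *ₛ h (toℕ k)) m) ≈ (g *ₛ (λ m → sum {N} (λ k → h (toℕ k) m))) m
  sum-*ₛ zero    g h m = sym (trans (*ₛ-comm g (λ _ → 0#) m) (*ₛ-zeroˡ (λ _ → 0#) g (λ _ → refl) m))
  sum-*ₛ (suc N) g h m = trans (+-congˡ (sum-*ₛ N g (λ k → h (suc k)) m))
    (sym (S.distribˡ g (h 0) (λ m → sum {N} (λ k → h (suc (toℕ k)) m)) m))

  module _ (f : Series) (f₀≈1 : f 0 ≈ 1#) where
    private
      g : Series
      g = C 1# -ₛ f

      g₀≈0 : g 0 ≈ 0#
      g₀≈0 = trans (+-congˡ (-‿cong f₀≈1)) (-‿inverseʳ 1#)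

      geometric : ℕ → Series
      geometric N m = sum {N} (λ k → (g ^ₛ toℕ k) m)

      geometric-suc : ∀ N m → geometric (suc N) m ≈ C 1# m + (g *ₛ geometric N) m
      geometric-suc N m = +-congˡ (sum-*ₛ N g (g ^ₛ_) m)

      -- The additional term `g ^ₛ N` is divisible by t^N. The induction expresses this by gaining
      -- one order at each use of `geometric-suc`.
      geometric-stable : ∀ N m → m < N → geometric (suc N) m ≈ geometric N m
      geometric-stable (suc N) m (s≤s m≤N) = begin
        geometric (2 ℕ.+ N) m                  ≈⟨ geometric-suc (suc N) m ⟩
        C 1# m + (g *ₛ geometric (suc N)) m    ≈⟨ +-congˡ (*ₛ-contraction g (geometric (suc N)) (geometric N) m g₀≈0
                                                    (λ {k} k<m → geometric-stable N k (ℕ.<-≤-trans k<m m≤N))) ⟩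
        C 1# m + (g *ₛ geometric N) m          ≈⟨ geometric-suc N m ⟨
        geometric (suc N) m                    ∎

      geometric≈recip : ∀ N m → m < N → geometric N m ≈ recip f m
      geometric≈recip (suc N) m (s≤s m≤N) with ℕ.m≤n⇒m<n∨m≡n m≤N
      ... | inj₁ m<N    = trans (geometric-stable N m m<N) (geometric≈recip N m m<N)
      -- Here `m = N`, and `recip f m` is `geometric (suc m) m` by definition.
      ... | inj₂ ≡.refl = refl

    -- `recip f` is a fixpoint of `h ↦ 1 + (1 - f) h`. At coefficient `n`, the partial sum inside
    -- the product may be replaced by `recip f`, since `1 - f` is divisible by t and the two agree
    -- below `n`.
    recip-inverseʳ : (f *ₛ recip f) ≈ₛ C 1#
    recip-inverseʳ = I.inverse-from-fixpoint f (recip f) λ n →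
      trans (geometric-suc n n) (+-congˡ (*ₛ-contraction g (geometric n) (recip f) n g₀≈0 (geometric≈recip n _)))

    recip-unique : ∀ h → (f *ₛ h) ≈ₛ C 1# → h ≈ₛ recip f
    recip-unique h fh≈1 = I.inverse-unique f h (recip f) fh≈1 recip-inverseʳ

  ^ₛ-constant : ∀ f → f 0 ≈ 1# → ∀ n → (f ^ₛ n) 0 ≈ 1#
  ^ₛ-constant f f₀≈1 zero    = refl
  ^ₛ-constant f f₀≈1 (suc n) = trans (+-identityʳ _) (trans (*-cong f₀≈1 (^ₛ-constant f f₀≈1 n)) (*-identityˡ 1#))

  -- The weights of the continued fraction are s i = u i * w with the u i absorbed
  -- into the left-hand sides, so that no division is needed.
  convergent-*ₛ : ∀ N (r s u : ℕ → Carrier) w (B : Series) (F : ℕ → Series) →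
    (∀ i → s i ≈ u i * w) →
    B ≈ₛ (F 0 -ₛ C (r 0) *ₛ t *ₛ F 0 -ₛ C w *ₛ t *ₛ F 1) →
    (∀ k → (C (u (suc k)) *ₛ t *ₛ F k) ≈ₛ
           (F (suc k) -ₛ C (r (suc k)) *ₛ t *ₛ F (suc k) -ₛ C w *ₛ t *ₛ F (suc (suc k)))) →
    ∀ {n} → n < N → (convergent r s N *ₛ B) n ≈ F 0 n
  convergent-*ₛ (suc N) r s u w B F s≈ B≈ F≈ {n} n<1+N = begin
    (recip G *ₛ B) n            ≈⟨ *ₛ-cong-≤ (recip G) (recip G) B (G *ₛ F 0) n (λ _ → refl)
                                     (λ {m} m≤n → G-*ₛ m (ℕ.≤-<-trans m≤n n<1+N)) ⟩
    (recip G *ₛ (G *ₛ F 0)) n   ≈⟨ *ₛ-assoc (recip G) G (F 0) n ⟨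
    (recip G *ₛ G *ₛ F 0) n     ≈⟨ *ₛ-cong {g = F 0} (λ m → trans (*ₛ-comm (recip G) G m) (recip-inverseʳ G G₀≈1 m)) (λ _ → refl) n ⟩
    (C 1# *ₛ F 0) n             ≈⟨ *ₛ-identityˡ (F 0) n ⟩
    F 0 n                       ∎
    where
    c = convergent (λ i → r (suc i)) (λ i → s (suc i)) N
    G = C 1# -ₛ C (r 0) *ₛ t -ₛ C (s 1) *ₛ t ^ₛ 2 *ₛ c
    -- Of `s 1 = u 1 * w`, the factor `u 1` passes into the right factor of the next level while `w`
    -- stays in this one.
    B′ = C (u 1) *ₛ t *ₛ F 0

    cB′≈F₁ : ∀ {m} → m < N → (c *ₛ B′) m ≈ F 1 m
    cB′≈F₁ = convergent-*ₛ N (λ i → r (suc i)) (λ i → s (suc i)) (λ i → u (suc i)) w B′ (λ k → F (suc k))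
      (λ i → s≈ (suc i)) (F≈ 0) (λ k → F≈ (suc k))

    G-*ₛ : ∀ m → m < suc N → B m ≈ (G *ₛ F 0) m
    G-*ₛ m (s≤s m≤N) = begin
      B m
        ≈⟨ B≈ m ⟩
      (F 0 -ₛ C (r 0) *ₛ t *ₛ F 0 -ₛ C w *ₛ t *ₛ F 1) m
        -- The factor `t` before `F 1` gains one order, so agreement of the next level below `N`
        -- suffices for every `m ≤ N`.
        ≈⟨ +-congˡ (-‿cong (*ₛ-contraction (C w *ₛ t) (c *ₛ B′) (F 1) m (trans (+-identityʳ _) (zeroʳ w))
             (λ k<m → cB′≈F₁ (ℕ.<-≤-trans k<m m≤N)))) ⟨
      (F 0 -ₛ C (r 0) *ₛ t *ₛ F 0 -ₛ C w *ₛ t *ₛ (c *ₛ B′)) m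
        ≈⟨ I.jfraction-denominator (C (r 0)) (C (s 1)) (C (u 1)) (C w) t c (F 0)
             (λ k → trans (C-cong (s≈ 1) k) (C-* (u 1) w k)) m ⟨
      (G *ₛ F 0) m ∎

    G₀≈1 : G 0 ≈ 1#
    G₀≈1 = trans (+-cong (+-congˡ (-‿cong (trans (+-identityʳ _) (zeroʳ (r 0)))))
                         (-‿cong (trans (+-identityʳ _) (trans (*-congʳ (trans (+-identityʳ _)
                           (trans (*-congˡ (trans (+-identityʳ _) (zeroˡ _))) (zeroʳ (s 1))))) (zeroˡ _)))))
                 (solve 0 (con 1ℚ :- con 0ℚ :- con 0ℚ := con 1ℚ) refl)
      where open Solver

-- Eigenvectors of derivations, and derivations acting on coefficients.

module DerivationProperties (A : ℚ-Algebra) (𝒟 : Derivation (ℚ-Algebra.commutativeRing A)) where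
  open ℚ-Algebra A
  open Derivation 𝒟
  open RawSemiringDefinitions (RawRing.rawSemiring rawRing) using (_^_)
  open Solver

  D-0# : D 0# ≈ 0#
  D-0# = trans (D-cong (sym (zeroˡ 0#))) (trans (leibniz 0# 0#)
    (trans (+-cong (zeroʳ (D 0#)) (zeroˡ (D 0#))) (+-identityʳ 0#)))

  D-1# : D 1# ≈ 0#
  D-1# = trans (solve 1 (λ d → d := d :* con 1ℚ :+ con 1ℚ :* d :- d) refl (D 1#))
    (trans (+-congʳ (trans (sym (leibniz 1# 1#)) (D-cong (*-identityˡ 1#)))) (-‿inverseʳ (D 1#)))

  -- Eigenvalues are logarithmic derivatives: they add over products, and `eigen-^` multiplies them
  -- by the exponent.
  eigen-* : ∀ a b f g → D f ≈ a * f → D g ≈ b * g → D (f * g) ≈ (a + b) * (f * g)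
  eigen-* a b f g Df≈af Dg≈bg = trans (leibniz f g) (trans (+-cong (*-congʳ Df≈af) (*-congˡ Dg≈bg))
    (solve 4 (λ a b f g → a :* f :* g :+ f :* (b :* g) := (a :+ b) :* (f :* g)) refl a b f g))

  eigen-^ : ∀ a f → D f ≈ a * f → ∀ n → D (f ^ n) ≈ φ (ν n) * a * f ^ n
  eigen-^ a f Df≈af zero    = trans D-1# (sym (trans (*-congʳ (trans (*-congʳ φ.0#-homo) (zeroˡ a))) (zeroˡ 1#)))
  eigen-^ a f Df≈af (suc n) = trans (eigen-* a (φ (ν n) * a) f (f ^ n) Df≈af (eigen-^ a f Df≈af n))
    (*-congʳ (trans (solve 2 (λ a m → a :+ m :* a := (con 1ℚ :+ m) :* a) refl a (φ (ν n))) (*-congʳ (sym (φν-suc n)))))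

  -- Derivations form a module over the ring. The operator `L`, that is d/dt - (1 + x²) d/dx, is
  -- obtained in this way.
  subtract-multiple : Derivation commutativeRing → Carrier → Derivation commutativeRing
  subtract-multiple ℰ c = record
    { D       = λ f → E f - c * D f
    ; D-cong  = λ p → +-cong (E-cong p) (-‿cong (*-congˡ (D-cong p)))
    ; D-+     = λ f g → trans (+-cong (E-+ f g) (-‿cong (*-congˡ (D-+ f g))))
                  (solve 5 (λ a b c p q → a :+ b :- c :* (p :+ q) := a :- c :* p :+ (b :- c :* q)) refl (E f) (E g) c (D f) (D g))
    ; D-neg   = λ f → trans (+-cong (E-neg f) (-‿cong (*-congˡ (D-neg f))))
                  (solve 3 (λ a c p → :- a :- c :* (:- p) := :- (a :- c :* p)) refl (E f) c (D f))
    ; leibniz = λ f g → trans (+-cong (E-leibniz f g) (-‿cong (*-congˡ (leibniz f g))))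
                  (solve 7 (λ f g a b c p q → a :* g :+ f :* b :- c :* (p :* g :+ f :* q) := (a :- c :* p) :* g :+ f :* (b :- c :* q))
                    refl f g (E f) (E g) c (D f) (D g))
    }
    where
    open Derivation ℰ renaming (D to E; D-cong to E-cong; D-+ to E-+; D-neg to E-neg; leibniz to E-leibniz)

module CoefficientwiseDerivation (A : ℚ-Algebra) (𝒟 : Derivation (ℚ-Algebra.commutativeRing A)) where
  open ℚ-Algebra A
  open Derivation 𝒟
  open DerivationProperties A 𝒟
  open PowerSeries rawRing
  open SeriesRing commutativeRing
  open SetoidReasoning setoid

  ∂ₓ : Series → Series
  ∂ₓ f n = D (f n)

  ∂ₓ-leibniz : ∀ f g n → ∂ₓ (f *ₛ g) n ≈ (∂ₓ f *ₛ g) n + (f *ₛ ∂ₓ g) n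
  ∂ₓ-leibniz f g zero    = begin
    D (f 0 * g 0 + 0#)                              ≈⟨ D-cong (+-identityʳ _) ⟩
    D (f 0 * g 0)                                   ≈⟨ leibniz (f 0) (g 0) ⟩
    D (f 0) * g 0 + f 0 * D (g 0)                   ≈⟨ +-cong (+-identityʳ _) (+-identityʳ _) ⟨
    (D (f 0) * g 0 + 0#) + (f 0 * D (g 0) + 0#)     ∎
  ∂ₓ-leibniz f g (suc n) = begin
    D (f 0 * g (suc n) + (tail f *ₛ g) n)
      ≈⟨ D-+ _ _ ⟩
    D (f 0 * g (suc n)) + D ((tail f *ₛ g) n)
      ≈⟨ +-cong (leibniz (f 0) (g (suc n))) (∂ₓ-leibniz (tail f) g n) ⟩
    (D (f 0) * g (suc n) + f 0 * D (g (suc n))) + ((∂ₓ (tail f) *ₛ g) n + (tail f *ₛ ∂ₓ g) n)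
      ≈⟨ interchange _ _ _ _ ⟩
    (∂ₓ f *ₛ g) (suc n) + (f *ₛ ∂ₓ g) (suc n) ∎
    where open import Algebra.Properties.CommutativeSemigroup +-commutativeSemigroup using (interchange)

  ∂ₓ-derivation : Derivation seriesRing
  ∂ₓ-derivation = record
    { D       = ∂ₓ
    ; D-cong  = λ p n → D-cong (p n)
    ; D-+     = λ f g n → D-+ (f n) (g n)
    ; D-neg   = λ f n → D-neg (f n)
    ; leibniz = ∂ₓ-leibniz
    }

-- Derivative polynomials over a differential algebra

record Differentialℚ-Algebra : Set₁ where
  field
    algebra    : ℚ-Algebra
    derivation : Derivation (ℚ-Algebra.commutativeRing algebra)
  open ℚ-Algebra algebra public
  open Derivation derivation public
  field
    D-φ : ∀ a → D (φ a) ≈ 0#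
    x   : Carrier
    D-x : D x ≈ 1#

  open DerivationProperties algebra derivation public
  open RawSemiringDefinitions (RawRing.rawSemiring rawRing) public using (_^_)

  D-scale : ∀ a f → D (φ a * f) ≈ φ a * D f
  D-scale a f = trans (leibniz (φ a) f) (trans (+-congʳ (trans (*-congʳ (D-φ a)) (zeroˡ f))) (+-identityˡ _))

module DerivativePolynomials (𝔸 : Differentialℚ-Algebra) where
  open Differentialℚ-Algebra 𝔸
  open PowerSeries rawRing
  open SeriesAlgebra algebra
  open CoefficientwiseDerivation algebra derivation

  w : Carrier
  w = 1# + x ^ 2

  D-x* : ∀ f → D (x * f) ≈ f + x * D f
  D-x* f = trans (leibniz x f) (+-congʳ (trans (*-congʳ D-x) (*-identityˡ f)))

  D-w : D w ≈ x + x
  D-w = begin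
    D (1# + x * (x * 1#))      ≈⟨ D-+ 1# (x * (x * 1#)) ⟩
    D 1# + D (x * (x * 1#))    ≈⟨ +-cong D-1# (D-x* (x * 1#)) ⟩
    0# + (x * 1# + x * D (x * 1#)) ≈⟨ +-congˡ (+-congˡ (*-congˡ (trans (D-cong (*-identityʳ x)) D-x))) ⟩
    0# + (x * 1# + x * 1#)     ≈⟨ solve 1 (λ x → con 0ℚ :+ (x :* con 1ℚ :+ x :* con 1ℚ) := x :+ x) refl x ⟩
    x + x                      ∎
    where
    open Solver
    open SetoidReasoning setoid

  -- Moving `D` past the operator `b x + w D` replaces `b` by `b + 2`, because `D w = 2 x`, and
  -- leaves behind `b f`, because `D x = 1`. Hence each level of the fraction adds `2 x` to `r`.
  D-first-order : ∀ b f → D (φ b * x * f + w * D f) ≈ φ b * f + φ (b ℚ.+ ν 2) * x * D f + w * D (D f)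
  D-first-order b f = begin
    D (φ b * x * f + w * D f)
      ≈⟨ D-+ _ _ ⟩
    D (φ b * x * f) + D (w * D f)
      ≈⟨ +-cong (trans (D-cong (*-assoc _ _ _)) (trans (D-scale b (x * f)) (*-congˡ (D-x* f))))
                (trans (leibniz w (D f)) (+-congʳ (*-congʳ D-w))) ⟩
    φ b * (f + x * D f) + ((x + x) * D f + w * D (D f))
      ≈⟨ solve 6 (λ b f x g w h → b :* (f :+ x :* g) :+ ((x :+ x) :* g :+ w :* h)
           := b :* f :+ (b :+ (con 1ℚ :+ con 1ℚ)) :* x :* g :+ w :* h) refl (φ b) f x (D f) w (D (D f)) ⟩
    φ b * f + (φ b + (1# + 1#)) * x * D f + w * D (D f)
      ≈⟨ +-congʳ (+-congˡ (*-congʳ (*-congʳ (+-congˡ (+-cong φ.1#-homo φ.1#-homo))))) ⟨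
    φ b * f + (φ b + (φ 1ℚ + φ 1ℚ)) * x * D f + w * D (D f)
      ≈⟨ +-congʳ (+-congˡ (*-congʳ (*-congʳ (trans (φ.+-homo b (ν 2)) (+-congˡ (φ.+-homo 1ℚ 1ℚ)))))) ⟨
    φ b * f + φ (b ℚ.+ ν 2) * x * D f + w * D (D f) ∎
    where
    open Solver
    open SetoidReasoning setoid

  D^ : ℕ → Carrier → Carrier
  D^ zero    f = f
  D^ (suc k) f = D (D^ k f)

  D^-suc-1# : ∀ k {f} → f ≈ 1# → D^ (suc k) f ≈ 0#
  D^-suc-1# zero    f≈1 = trans (D-cong f≈1) D-1#
  D^-suc-1# (suc k) f≈1 = trans (D-cong (D^-suc-1# k f≈1)) D-0#

  module _ (δ : ℕ) (q : ℕ → Carrier) (q-zero : q 0 ≈ 1#)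
           (q-suc : ∀ n → q (suc n) ≈ φ (ν δ) * x * q n + w * D (q n)) where

    -- The truncated subtraction is harmless: `u 0` has the factor `0`, and at `suc k` the
    -- difference computes to `k + δ`.
    r u : ℕ → Carrier
    r k = φ (ν (2 ℕ.* k ℕ.+ δ)) * x
    u k = φ (ν (k ℕ.* ((k ℕ.+ δ) ℕ.∸ 1)))

    F : ℕ → Series
    F k n = D^ k (q n)

    -- Each further differentiation is one use of `D-first-order`. The term it leaves behind adds
    -- `2 (k + 1) + δ` to `u (suc k)`, and these increments sum to the product formula for `u`.
    F-suc : ∀ k n → D^ (suc k) (q (suc n)) ≈
      u (suc k) * D^ k (q n) + r (suc k) * D^ (suc k) (q n) + w * D^ (2 ℕ.+ k) (q n)
    F-suc zero n = begin
      D (q (suc n))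
        ≈⟨ D-cong (q-suc n) ⟩
      D (φ (ν δ) * x * q n + w * D (q n))
        ≈⟨ D-first-order (ν δ) (q n) ⟩
      φ (ν δ) * q n + φ (ν δ ℚ.+ ν 2) * x * D (q n) + w * D (D (q n))
        ≈⟨ +-congʳ (+-cong (*-congʳ (reflexive (≡.cong (λ m → φ (ν m)) (≡.sym (ℕ.*-identityˡ δ)))))
             (*-congʳ (*-congʳ (reflexive (≡.cong φ (≡.trans (ℚ.+-comm (ν δ) (ν 2)) (≡.sym (/1-homo-+ (+ 2) (+ δ))))))))) ⟩
      u 1 * q n + r 1 * D (q n) + w * D (D (q n)) ∎
      where open SetoidReasoning setoid
    F-suc (suc k) n = begin
      D (D^ (suc k) (q (suc n)))
        ≈⟨ D-cong (F-suc k n) ⟩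
      D (u (suc k) * f + φ b * x * D f + w * D (D f))
        ≈⟨ trans (D-cong (+-assoc _ _ _)) (D-+ _ _) ⟩
      D (u (suc k) * f) + D (φ b * x * D f + w * D (D f))
        ≈⟨ +-cong (D-scale _ f) (D-first-order b (D f)) ⟩
      u (suc k) * D f + (φ b * D f + φ (b ℚ.+ ν 2) * x * D (D f) + w * D (D (D f)))
        ≈⟨ solve 5 (λ a b f g h → a :* f :+ (b :* f :+ g :+ h) := (a :+ b) :* f :+ g :+ h)
             refl (u (suc k)) (φ b) (D f) (φ (b ℚ.+ ν 2) * x * D (D f)) (w * D (D (D f))) ⟩
      (u (suc k) + φ b) * D f + φ (b ℚ.+ ν 2) * x * D (D f) + w * D (D (D f))
        ≈⟨ +-congʳ (+-cong (*-congʳ u-suc) (*-congʳ (*-congʳ r-suc))) ⟩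
      u (2 ℕ.+ k) * D f + r (2 ℕ.+ k) * D (D f) + w * D (D (D f)) ∎
      where
      open Solver
      open SetoidReasoning setoid
      f = D^ k (q n)
      b = ν (2 ℕ.* suc k ℕ.+ δ)

      u-suc : u (suc k) + φ b ≈ u (2 ℕ.+ k)
      u-suc = trans (sym (φ.+-homo _ b)) (reflexive (≡.cong φ (≡.trans
        (≡.sym (/1-homo-+ (+ (suc k ℕ.* (k ℕ.+ δ))) (+ (2 ℕ.* suc k ℕ.+ δ))))
        (≡.cong ν (lemma k δ)))))
        where
        lemma : ∀ k δ → suc k ℕ.* (k ℕ.+ δ) ℕ.+ (2 ℕ.* suc k ℕ.+ δ) ≡ (2 ℕ.+ k) ℕ.* (suc k ℕ.+ δ)
        lemma = solve-∀

      r-suc : φ (b ℚ.+ ν 2) ≈ φ (ν (2 ℕ.* (2 ℕ.+ k) ℕ.+ δ))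
      r-suc = reflexive (≡.cong φ (≡.trans (≡.sym (/1-homo-+ (+ (2 ℕ.* suc k ℕ.+ δ)) (+ 2))) (≡.cong ν (lemma k δ))))
        where
        lemma : ∀ k δ → 2 ℕ.* suc k ℕ.+ δ ℕ.+ 2 ≡ 2 ℕ.* (2 ℕ.+ k) ℕ.+ δ
        lemma = solve-∀

    -- The top level has left-hand side `1`, since `q 0 = 1` and the recurrence of `q` has no `u`
    -- term. In the lower levels the constant terms vanish because the derivatives of `q 0` do.
    q-jfraction : ∀ (s : ℕ → Carrier) → (∀ i → s i ≈ u i * w) → ∀ N {n} → n < N → convergent r s N n ≈ q n
    q-jfraction s s≈ N {n} n<N = trans
      (sym (trans (*ₛ-comm (convergent r s N) (C 1#) n) (*ₛ-identityˡ (convergent r s N) n)))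
      (convergent-*ₛ N r s u w (C 1#) F s≈ first next n<N)
      where
      open Solver
      expand-zero : ∀ k a → D^ k (q 0) ≈ a →
        a ≈ (F k -ₛ C (r k) *ₛ t *ₛ F k -ₛ C w *ₛ t *ₛ F (suc k)) 0
      expand-zero k a q₀≈a = sym (trans
        (+-cong (+-cong q₀≈a (-‿cong (C-t-*ₛ-zero (r k) (F k)))) (-‿cong (C-t-*ₛ-zero w (F (suc k)))))
        (solve 1 (λ a → a :- con 0ℚ :- con 0ℚ := a) refl a))

      expand-suc : ∀ k a n → D^ k (q (suc n)) ≈ a + r k * D^ k (q n) + w * D^ (suc k) (q n) →
        a ≈ (F k -ₛ C (r k) *ₛ t *ₛ F k -ₛ C w *ₛ t *ₛ F (suc k)) (suc n)
      expand-suc k a n p = sym (trans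
        (+-cong (+-cong p (-‿cong (C-t-*ₛ-suc (r k) (F k) n))) (-‿cong (C-t-*ₛ-suc w (F (suc k)) n)))
        (solve 3 (λ a b c → a :+ b :+ c :- b :- c := a) refl a (r k * D^ k (q n)) (w * D^ (suc k) (q n))))

      first : C 1# ≈ₛ _
      first zero    = expand-zero 0 1# q-zero
      first (suc n) = expand-suc 0 0# n (trans (q-suc n) (+-congʳ (sym (+-identityˡ _))))

      next : ∀ k → (C (u (suc k)) *ₛ t *ₛ F k) ≈ₛ _
      next k zero    = trans (C-t-*ₛ-zero (u (suc k)) (F k)) (expand-zero (suc k) 0# (D^-suc-1# k q-zero))
      next k (suc n) = trans (C-t-*ₛ-suc (u (suc k)) (F k) n) (expand-suc (suc k) _ n (F-suc k n))

    taylor : (ℕ → ℤ) → Series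
    taylor f n = φ (f n / 1 ℚ.* 1/ n !)

    cosₛ sinₛ denominator qₑ : Series
    cosₛ = taylor cosℤ
    sinₛ = taylor sinℤ
    denominator = cosₛ -ₛ C x *ₛ sinₛ
    qₑ n = φ (1/ n !) * q n

    private
      module S = ℚ-Algebra seriesAlgebra
      module I = Identities seriesAlgebra
      module ∂ₜ-properties = DerivationProperties seriesAlgebra ∂ₜ-derivation
      module ∂ₓ-properties = DerivationProperties seriesAlgebra ∂ₓ-derivation

      -- The generating function and the inverse of its claimed value are eigenvectors
      -- of L with opposite eigenvalues, so L annihilates their product.
      transport : Derivation seriesRing
      transport = ∂ₓ-properties.subtract-multiple ∂ₜ-derivation (C w)

      module L-properties = DerivationProperties seriesAlgebra transport
      open Derivation transport using () renaming (D to L)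

      C-w : C w ≈ₛ (C 1# +ₛ C x ^ₛ 2)
      C-w = S.trans {C w} {C 1# +ₛ C (x ^ 2)} {C 1# +ₛ C x ^ₛ 2} (C-+ 1# (x ^ 2))
        (S.+-congˡ {C 1#} {C (x ^ 2)} {C x ^ₛ 2}
          (S.trans {C (x ^ 2)} {C x *ₛ C (x * 1#)} {C x ^ₛ 2} (C-* x (x * 1#))
            (S.*-congˡ {C x} {C (x * 1#)} {C x *ₛ C 1#} (C-* x 1#))))

      ∂ₜ-taylor : ∀ f n → ∂ₜ (taylor f) n ≈ taylor (λ k → f (suc k)) n
      ∂ₜ-taylor f n = trans (sym (φ.*-homo _ _)) (reflexive (≡.cong φ (ν-*-/! (f (suc n) / 1) n)))

      ∂ₜ-sin : ∂ₜ sinₛ ≈ₛ cosₛ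
      ∂ₜ-sin n = trans (∂ₜ-taylor sinℤ n) (reflexive (≡.cong (λ i → φ (i / 1 ℚ.* 1/ n !)) (sinℤ-suc n)))

      ∂ₜ-cos : ∂ₜ cosₛ ≈ₛ (S.- sinₛ)
      ∂ₜ-cos n = trans (∂ₜ-taylor cosℤ n) (trans
        (reflexive (≡.cong φ (≡.trans
          (≡.cong (ℚ._* 1/ n !) (≡.trans (≡.cong (_/ 1) (cosℤ-suc n)) (/1-homo-neg (sinℤ n))))
          (≡.sym (ℚ.neg-distribˡ-* (sinℤ n / 1) (1/ n !))))))
        (φ.-‿homo _))

      ∂ₜ-C : ∀ a → ∂ₜ (C a) ≈ₛ C 0#
      ∂ₜ-C a n = trans (zeroʳ _) (sym (C-0# n))

      ∂ₜ-denominator : ∂ₜ denominator ≈ₛ (S.- sinₛ -ₛ C x *ₛ cosₛ)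
      ∂ₜ-denominator n = begin
        ∂ₜ denominator n
          ≈⟨ ∂ₜ-D-+ cosₛ (S.- (C x *ₛ sinₛ)) n ⟩
        ∂ₜ cosₛ n + ∂ₜ (S.- (C x *ₛ sinₛ)) n
          ≈⟨ +-cong (∂ₜ-cos n) (∂ₜ-D-neg (C x *ₛ sinₛ) n) ⟩
        - sinₛ n + - ∂ₜ (C x *ₛ sinₛ) n
          ≈⟨ +-congˡ (-‿cong (begin
            ∂ₜ (C x *ₛ sinₛ) n
              ≈⟨ ∂ₜ-leibniz (C x) sinₛ n ⟩
            (∂ₜ (C x) *ₛ sinₛ) n + (C x *ₛ ∂ₜ sinₛ) n
              ≈⟨ +-cong (S.*-congʳ {sinₛ} {∂ₜ (C x)} {C 0#} (∂ₜ-C x) n) (S.*-congˡ {C x} {∂ₜ sinₛ} {cosₛ} ∂ₜ-sin n) ⟩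
            (C 0# *ₛ sinₛ) n + (C x *ₛ cosₛ) n
              ≈⟨ trans (+-congʳ (trans (S.zeroˡ sinₛ n) (C-0# n))) (+-identityˡ _) ⟩
            (C x *ₛ cosₛ) n ∎)) ⟩
        - sinₛ n + - (C x *ₛ cosₛ) n ∎
        where
        open SetoidReasoning setoid
        open Derivation ∂ₜ-derivation using () renaming (D-+ to ∂ₜ-D-+; D-neg to ∂ₜ-D-neg)

      ∂ₓ-denominator : ∂ₓ denominator ≈ₛ (S.- sinₛ)
      ∂ₓ-denominator n = begin
        D (cosₛ n + - (C x *ₛ sinₛ) n)
          ≈⟨ trans (D-+ _ _) (+-cong (D-φ _) (D-neg _)) ⟩
        0# + - D ((C x *ₛ sinₛ) n)
          ≈⟨ trans (+-identityˡ _) (-‿cong (D-cong (C-*ₛ x sinₛ n))) ⟩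
        - D (x * sinₛ n)
          ≈⟨ -‿cong (trans (D-x* (sinₛ n)) (trans (+-congˡ (trans (*-congˡ (D-φ _)) (zeroʳ x))) (+-identityʳ _))) ⟩
        - sinₛ n ∎
        where open SetoidReasoning setoid

      -- The t-derivative is `- sin - x cos` and the x-derivative is `- sin`. Thus `L` gives `- sin
      -- - x cos + (1 + x²) sin = - x (cos - x sin)`.
      L-denominator : L denominator ≈ₛ (S.- C x *ₛ denominator)
      L-denominator = begin
        ∂ₜ denominator -ₛ C w *ₛ ∂ₓ denominator
          ≈⟨ S.+-cong {∂ₜ denominator} {S.- sinₛ -ₛ C x *ₛ cosₛ} ∂ₜ-denominator
               (S.-‿cong {C w *ₛ ∂ₓ denominator} {(C 1# +ₛ C x ^ₛ 2) *ₛ (S.- sinₛ)}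
                 (S.*-cong {C w} {C 1# +ₛ C x ^ₛ 2} {∂ₓ denominator} {S.- sinₛ} C-w ∂ₓ-denominator)) ⟩
        (S.- sinₛ -ₛ C x *ₛ cosₛ) -ₛ (C 1# +ₛ C x ^ₛ 2) *ₛ (S.- sinₛ)
          ≈⟨ I.rotation cosₛ sinₛ (C x) ⟩
        S.- C x *ₛ denominator ∎
        where open SetoidReasoning S.setoid

      δₛ : Series
      δₛ = S.φ (ν δ)

      -- The t-derivative shifts `q n` to `q (suc n)`; in the recurrence the term `w * D (q n)` is
      -- exactly what `L` subtracts, leaving `δ x`.
      L-qₑ : L qₑ ≈ₛ (δₛ *ₛ C x *ₛ qₑ)
      L-qₑ n = begin
        φ (ν (suc n)) * (φ (1/ suc n !) * q (suc n)) - (C w *ₛ ∂ₓ qₑ) n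
          ≈⟨ +-cong (trans (sym (*-assoc _ _ _)) (*-cong (trans (sym (φ.*-homo _ _)) (reflexive (≡.cong φ (ν-*-1/! n)))) (q-suc n)))
                    (-‿cong (trans (C-*ₛ w (∂ₓ qₑ) n) (*-congˡ (D-scale _ (q n))))) ⟩
        a * (φ (ν δ) * x * q n + w * D (q n)) - w * (a * D (q n))
          ≈⟨ solve 6 (λ a d x q w f → a :* (d :* x :* q :+ w :* f) :- w :* (a :* f) := d :* (x :* (a :* q))) refl a (φ (ν δ)) x (q n) w (D (q n)) ⟩
        φ (ν δ) * (x * (a * q n))
          ≈⟨ *-congˡ (C-*ₛ x qₑ n) ⟨
        φ (ν δ) * (C x *ₛ qₑ) n
          ≈⟨ C-*ₛ (φ (ν δ)) (C x *ₛ qₑ) n ⟨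
        (δₛ *ₛ (C x *ₛ qₑ)) n
          ≈⟨ *ₛ-assoc δₛ (C x) qₑ n ⟨
        (δₛ *ₛ C x *ₛ qₑ) n ∎
        where
        open SetoidReasoning setoid
        open Solver
        a = φ (1/ n !)

      L-product : L (denominator ^ₛ δ *ₛ qₑ) ≈ₛ C 0#
      L-product = S.trans {L (denominator ^ₛ δ *ₛ qₑ)} {(δₛ *ₛ (S.- C x) +ₛ δₛ *ₛ C x) *ₛ (denominator ^ₛ δ *ₛ qₑ)} {C 0#}
        (L-properties.eigen-* (δₛ *ₛ (S.- C x)) (δₛ *ₛ C x) (denominator ^ₛ δ) qₑ
          (L-properties.eigen-^ (S.- C x) denominator L-denominator δ) L-qₑ)
        (I.cancel-eigenvalues δₛ (C x) (denominator ^ₛ δ *ₛ qₑ))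

      φ-ν-cancel : ∀ n a → φ (ν (suc n)) * a ≈ 0# → a ≈ 0#
      φ-ν-cancel n a p = begin
        a                                          ≈⟨ *-identityˡ a ⟨
        1# * a                                     ≈⟨ *-congʳ φ.1#-homo ⟨
        φ 1ℚ * a                                   ≈⟨ *-congʳ (reflexive (≡.cong φ (ν-inverse n))) ⟨
        φ (ν (suc n) ℚ.* (+ 1 / suc n)) * a        ≈⟨ *-congʳ (trans (φ.*-homo _ _) (*-comm _ _)) ⟩
        φ (+ 1 / suc n) * φ (ν (suc n)) * a        ≈⟨ trans (*-assoc _ _ _) (trans (*-congˡ p) (zeroʳ _)) ⟩
        0#                                         ∎
        where open SetoidReasoning setoid

      -- `L f = 0` says that `n + 1` times coefficient `n + 1` equals `w` times the derivative of
      -- coefficient `n`. Starting from `1`, whose derivative is zero, all higher coefficients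
      -- vanish.
      L-constant : ∀ f → L f ≈ₛ C 0# → f 0 ≈ 1# → f ≈ₛ C 1#
      L-constant f Lf≈0 f₀≈1 zero    = f₀≈1
      L-constant f Lf≈0 f₀≈1 (suc n) = φ-ν-cancel n (f (suc n)) (begin
        ∂ₜ f n                                    ≈⟨ solve 2 (λ a b → a := (a :- b) :+ b) refl (∂ₜ f n) ((C w *ₛ ∂ₓ f) n) ⟩
        L f n + (C w *ₛ ∂ₓ f) n                   ≈⟨ +-cong (trans (Lf≈0 n) (C-0# n)) (C-*ₛ w (∂ₓ f) n) ⟩
        0# + w * D (f n)                          ≈⟨ trans (+-identityˡ _) (*-congˡ (trans (D-cong (L-constant f Lf≈0 f₀≈1 n)) (D-C n))) ⟩
        w * 0#                                    ≈⟨ zeroʳ w ⟩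
        0#                                        ∎)
        where
        open SetoidReasoning setoid
        open Solver
        D-C : ∀ n → D (C 1# n) ≈ 0#
        D-C zero    = D-1#
        D-C (suc n) = D-0#

      denominator₀≈1 : denominator 0 ≈ 1#
      denominator₀≈1 = trans
        (+-cong φ.1#-homo (-‿cong (trans (C-*ₛ x sinₛ 0) (trans (*-congˡ φ.0#-homo) (zeroʳ x)))))
        (solve 0 (con 1ℚ :- con 0ℚ := con 1ℚ) refl)
        where open Solver

    qₑ≈recip : qₑ ≈ₛ recip (denominator ^ₛ δ)
    qₑ≈recip = recip-unique (denominator ^ₛ δ) constant qₑ (L-constant (denominator ^ₛ δ *ₛ qₑ) L-product
      (trans (+-identityʳ _) (trans (*-cong constant (trans (*-cong φ.1#-homo q-zero) (*-identityˡ 1#))) (*-identityˡ 1#))))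
      where
      constant : (denominator ^ₛ δ) 0 ≈ 1#
      constant = ^ₛ-constant denominator denominator₀≈1 δ

open PowerSeries ℚ.+-*-rawRing using () renaming (_*ₛ_ to _*ℚ_)

-- The differential algebra ℚ[x]

ℚ-algebra : ℚ-Algebra
ℚ-algebra = record
  { commutativeRing  = ℚ.+-*-commutativeRing
  ; φ                = λ q → q
  ; φ-isHomomorphism = record
    { isSemiringHomomorphism = record
      { isNearSemiringHomomorphism = record
        { +-isMonoidHomomorphism = record
          { isMagmaHomomorphism = record
            { isRelHomomorphism = record { cong = λ p → p }
            ; homo = λ _ _ → ≡.refl
            }
          ; ε-homo = ≡.refl
          }
        ; *-homo = λ _ _ → ≡.refl
        }
      ; 1#-homo = ≡.refl
      }
    ; -‿homo = λ _ → ≡.refl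
    }
  }

private module ℚ[[x]] = SeriesAlgebra ℚ-algebra

coeff-*ₚ : ∀ p q k → coeff (p *ₚ q) k ≡ (coeff p *ℚ coeff q) k
coeff-*ₚ []      q k       = ≡.sym (ℚ[[x]].*ₛ-zeroˡ (coeff []) (coeff q) (λ _ → ≡.refl) k)
coeff-*ₚ (a ∷ p) q zero    = coeff-∷* a p q zero
coeff-*ₚ (a ∷ p) q (suc k) = ≡.trans (coeff-∷* a p q (suc k)) (≡.cong (a ℚ.* coeff q (suc k) ℚ.+_) (coeff-*ₚ p q k))

coeff-neg : ∀ p k → coeff (-ₚ p) k ≡ ℚ.- coeff p k
coeff-neg []      k       = ≡.refl
coeff-neg (a ∷ p) zero    = ≡.refl
coeff-neg (a ∷ p) (suc k) = coeff-neg p k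

coeff-1ₚ : ∀ k → coeff 1ₚ k ≡ PowerSeries.C ℚ.+-*-rawRing 1ℚ k
coeff-1ₚ zero    = ≡.refl
coeff-1ₚ (suc k) = ≡.refl

-- Polynomials embed in the power series over ℚ, injectively because `_≈ₚ_` is equality of
-- coefficients. The ring laws for coefficient lists are pulled back along this map.
coeff-isMonomorphism : IsRingMonomorphism ℚ[x] (CommutativeRing.rawRing ℚ[[x]].seriesRing) coeff
coeff-isMonomorphism = record
  { isRingHomomorphism = record
    { isSemiringHomomorphism = record
      { isNearSemiringHomomorphism = record
        { +-isMonoidHomomorphism = record
          { isMagmaHomomorphism = record
            { isRelHomomorphism = record { cong = λ p → p }
            ; homo = coeff-+ₚ
            }
          ; ε-homo = λ k → ≡.sym (ℚ[[x]].C-0# k)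
          }
        ; *-homo = coeff-*ₚ
        }
      ; 1#-homo = coeff-1ₚ
      }
    ; -‿homo = coeff-neg
    }
  ; injective = λ p → p
  }

polyRing : CommutativeRing 0ℓ 0ℓ
polyRing = record
  { isCommutativeRing = RingMonomorphism.isCommutativeRing coeff-isMonomorphism
      (CommutativeRing.isCommutativeRing ℚ[[x]].seriesRing)
  }

private module ℚ[x]ᵣ = CommutativeRing polyRing

const-+ : ∀ a b → const (a ℚ.+ b) ≈ₚ const a +ₚ const b
const-+ a b zero    = ≡.refl
const-+ a b (suc k) = ≡.refl

const-*ₚ : ∀ a p → const a *ₚ p ≈ₚ map (a ℚ.*_) p
const-*ₚ a p k = ≡.trans (coeff-+ₚ (map (a ℚ.*_) p) (0ℚ ∷ []) k)
  (≡.trans (≡.cong (coeff (map (a ℚ.*_) p) k ℚ.+_) (∷-zero {p = []} ≡.refl (λ _ → ≡.refl) k)) (ℚ.+-identityʳ _))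

polyAlgebra : ℚ-Algebra
polyAlgebra = record
  { commutativeRing  = polyRing
  ; φ                = const
  ; φ-isHomomorphism = record
    { isSemiringHomomorphism = record
      { isNearSemiringHomomorphism = record
        { +-isMonoidHomomorphism = record
          { isMagmaHomomorphism = record
            { isRelHomomorphism = record { cong = λ { ≡.refl _ → ≡.refl } }
            ; homo = const-+
            }
          ; ε-homo = ∷-zero {p = []} ≡.refl (λ _ → ≡.refl)
          }
        ; *-homo = λ a b k → ≡.sym (const-*ₚ a (const b) k)
        }
      ; 1#-homo = λ _ → ≡.refl
      }
    ; -‿homo = λ _ _ → ≡.refl
    }
  }

coeff-derivFrom : ∀ j p k → coeff (derivFrom j p) k ≡ ν (j ℕ.+ k) ℚ.* coeff p k
coeff-derivFrom j []      k       = ≡.sym (ℚ.*-zeroʳ (ν (j ℕ.+ k)))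
coeff-derivFrom j (a ∷ p) zero    = ≡.cong (λ i → ν i ℚ.* a) (≡.sym (ℕ.+-identityʳ j))
coeff-derivFrom j (a ∷ p) (suc k) = ≡.trans (coeff-derivFrom (suc j) p k)
  (≡.cong (λ i → ν i ℚ.* coeff p k) (≡.sym (ℕ.+-suc j k)))

coeff-deriv : ∀ p k → coeff (deriv p) k ≡ ν (suc k) ℚ.* coeff p (suc k)
coeff-deriv []      k = ≡.sym (ℚ.*-zeroʳ (ν (suc k)))
coeff-deriv (a ∷ p) k = coeff-derivFrom 1 p k

-- Under the embedding, `deriv` becomes `∂ₜ`, with x in the role of the series variable, so its
-- Leibniz rule transfers.
deriv-leibniz : ∀ p q → deriv (p *ₚ q) ≈ₚ deriv p *ₚ q +ₚ p *ₚ deriv q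
deriv-leibniz p q k = begin
  coeff (deriv (p *ₚ q)) k
    ≡⟨ coeff-deriv (p *ₚ q) k ⟩
  ν (suc k) ℚ.* coeff (p *ₚ q) (suc k)
    ≡⟨ ≡.cong (ν (suc k) ℚ.*_) (coeff-*ₚ p q (suc k)) ⟩
  ℚ[[x]].∂ₜ (coeff p *ℚ coeff q) k
    ≡⟨ ℚ[[x]].∂ₜ-leibniz (coeff p) (coeff q) k ⟩
  (ℚ[[x]].∂ₜ (coeff p) *ℚ coeff q) k ℚ.+ (coeff p *ℚ ℚ[[x]].∂ₜ (coeff q)) k
    ≡⟨ ≡.cong₂ ℚ._+_ (ℚ[[x]].*ₛ-cong {g = coeff q} (coeff-deriv p) (λ _ → ≡.refl) k)
                     (ℚ[[x]].*ₛ-cong {f = coeff p} (λ _ → ≡.refl) (coeff-deriv q) k) ⟨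
  (coeff (deriv p) *ℚ coeff q) k ℚ.+ (coeff p *ℚ coeff (deriv q)) k
    ≡⟨ ≡.cong₂ ℚ._+_ (coeff-*ₚ (deriv p) q k) (coeff-*ₚ p (deriv q) k) ⟨
  coeff (deriv p *ₚ q) k ℚ.+ coeff (p *ₚ deriv q) k
    ≡⟨ coeff-+ₚ (deriv p *ₚ q) (p *ₚ deriv q) k ⟨
  coeff (deriv p *ₚ q +ₚ p *ₚ deriv q) k ∎
  where open ≡.≡-Reasoning

deriv-derivation : Derivation polyRing
deriv-derivation = record
  { D       = deriv
  ; D-cong  = λ {p} {q} p≈q k → ≡.trans (coeff-deriv p k) (≡.trans (≡.cong (ν (suc k) ℚ.*_) (p≈q (suc k))) (≡.sym (coeff-deriv q k)))
  ; D-+     = λ p q k → ≡.trans (coeff-deriv (p +ₚ q) k) (≡.trans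
      (≡.trans (≡.cong (ν (suc k) ℚ.*_) (coeff-+ₚ p q (suc k))) (ℚ.*-distribˡ-+ (ν (suc k)) (coeff p (suc k)) (coeff q (suc k))))
      (≡.sym (≡.trans (coeff-+ₚ (deriv p) (deriv q) k) (≡.cong₂ ℚ._+_ (coeff-deriv p k) (coeff-deriv q k)))))
  ; D-neg   = λ p k → ≡.trans (coeff-deriv (-ₚ p) k) (≡.trans
      (≡.trans (≡.cong (ν (suc k) ℚ.*_) (coeff-neg p (suc k))) (≡.sym (ℚ.neg-distribʳ-* (ν (suc k)) (coeff p (suc k)))))
      (≡.sym (≡.trans (coeff-neg (deriv p) k) (≡.cong ℚ.-_ (coeff-deriv p k)))))
  ; leibniz = deriv-leibniz
  }

polyDifferential : Differentialℚ-Algebra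
polyDifferential = record
  { algebra    = polyAlgebra
  ; derivation = deriv-derivation
  ; D-φ        = λ _ _ → ≡.refl
  ; x          = X
  ; D-x        = λ _ → ≡.refl
  }

X-*ₚ : ∀ p → X *ₚ p ≈ₚ 0ℚ ∷ p
X-*ₚ p k = ≡.trans (coeff-∷* 0ℚ 1ₚ p k) (≡.trans (≡.cong₂ ℚ._+_ (ℚ.*-zeroˡ (coeff p k)) (shifted k)) (ℚ.+-identityˡ _))
  where
  shifted : ∀ k → coeff (0ℚ ∷ 1ₚ *ₚ p) k ≡ coeff (0ℚ ∷ p) k
  shifted zero    = ≡.refl
  shifted (suc k) = ℚ[x]ᵣ.*-identityˡ p k

-- The product rule for `a + x p`. It gives `deriv` a structural recursion, which the counter in
-- `derivFrom` hides.
deriv-∷ : ∀ a p → deriv (a ∷ p) ≈ₚ p +ₚ (0ℚ ∷ deriv p)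
deriv-∷ a p k = ≡.trans (coeff-deriv (a ∷ p) k) (≡.trans (expand k) (≡.sym (coeff-+ₚ p (0ℚ ∷ deriv p) k)))
  where
  expand : ∀ k → ν (suc k) ℚ.* coeff p k ≡ coeff p k ℚ.+ coeff (0ℚ ∷ deriv p) k
  expand zero    = ≡.trans (ℚ.*-identityˡ (coeff p 0)) (≡.sym (ℚ.+-identityʳ (coeff p 0)))
  expand (suc k) = begin
    ν (2 ℕ.+ k) ℚ.* coeff p (suc k)                              ≡⟨ ≡.cong (ℚ._* coeff p (suc k)) (ν-suc (suc k)) ⟩
    (1ℚ ℚ.+ ν (suc k)) ℚ.* coeff p (suc k)                       ≡⟨ ℚ.*-distribʳ-+ (coeff p (suc k)) 1ℚ (ν (suc k)) ⟩
    1ℚ ℚ.* coeff p (suc k) ℚ.+ ν (suc k) ℚ.* coeff p (suc k)     ≡⟨ ≡.cong₂ ℚ._+_ (ℚ.*-identityˡ (coeff p (suc k))) (≡.sym (coeff-deriv p k)) ⟩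
    coeff p (suc k) ℚ.+ coeff (deriv p) k                        ∎
    where open ≡.≡-Reasoning

X+1-cancel : ∀ p q → (X +ₚ 1ₚ) *ₚ p ≈ₚ (X +ₚ 1ₚ) *ₚ q → p ≈ₚ q
X+1-cancel p q eq with ℚ[x]-domain (X +ₚ 1ₚ) (p +ₚ -ₚ q) v[p-q]≈0
  where
  v = X +ₚ 1ₚ
  v[p-q]≈0 : v *ₚ (p +ₚ -ₚ q) ≈ₚ 0ₚ
  v[p-q]≈0 = ℚ[x]ᵣ.trans {v *ₚ (p +ₚ -ₚ q)} {v *ₚ p +ₚ v *ₚ (-ₚ q)} {0ₚ} (ℚ[x]ᵣ.distribˡ v p (-ₚ q))
    (ℚ[x]ᵣ.trans {v *ₚ p +ₚ v *ₚ (-ₚ q)} {v *ₚ q +ₚ -ₚ (v *ₚ q)} {0ₚ}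
      (ℚ[x]ᵣ.+-cong {v *ₚ p} {v *ₚ q} {v *ₚ (-ₚ q)} { -ₚ (v *ₚ q)} eq
        (λ k → ≡.sym (RingProperties.-‿distribʳ-* ℚ[x]ᵣ.ring v q k)))
      (ℚ[x]ᵣ.-‿inverseʳ (v *ₚ q)))
... | inj₁ v≈0   = contradiction v≈0 X+1≉0
... | inj₂ p-q≈0 = RingProperties.x∙y⁻¹≈ε⇒x≈y ℚ[x]ᵣ.ring p q p-q≈0

-- The substitution y = (x - 1)/(x + 1)

-- Identities at `u / v` are multiplied out by powers of `x + 1`; cancellation then takes the place
-- of division.
[x+1]-Cancellative : Differentialℚ-Algebra → Set
[x+1]-Cancellative 𝔸 = ∀ f g → (x + 1#) * f ≈ (x + 1#) * g → f ≈ g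
  where open Differentialℚ-Algebra 𝔸

module Substitution (𝔸 : Differentialℚ-Algebra) (v-cancel : [x+1]-Cancellative 𝔸) where
  open Differentialℚ-Algebra 𝔸
  open Solver
  open SetoidReasoning setoid

  u v : Carrier
  u = x + - 1#
  v = x + 1#

  -- The value of p at u / v is num p / den p, in the unreduced form produced by eval.
  num den : Poly → Carrier
  num []      = 0#
  num (a ∷ p) = φ a * (v * den p) + u * num p * 1#
  den []      = 1#
  den (a ∷ p) = 1# * (v * den p)

  -- h = v ^ m * p (u / v)
  Represents : Poly → ℕ → Carrier → Set
  Represents p m h = v ^ m * num p ≈ h * den p

  v^-cancel : ∀ m f g → v ^ m * f ≈ v ^ m * g → f ≈ g
  v^-cancel zero    f g eq = trans (sym (*-identityˡ f)) (trans eq (*-identityˡ g))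
  v^-cancel (suc m) f g eq = v^-cancel m f g (v-cancel _ _ (trans (sym (*-assoc _ _ _)) (trans eq (*-assoc _ _ _))))

  den≈v^ : ∀ p → den p ≈ v ^ length p
  den≈v^ []      = refl
  den≈v^ (a ∷ p) = trans (*-identityˡ _) (*-congˡ (den≈v^ p))

  den-cancel : ∀ p f g → f * den p ≈ g * den p → f ≈ g
  den-cancel p f g eq = v^-cancel (length p) f g (begin
    v ^ length p * f  ≈⟨ trans (*-comm _ _) (*-congˡ (sym (den≈v^ p))) ⟩
    f * den p         ≈⟨ eq ⟩
    g * den p         ≈⟨ trans (*-congˡ (den≈v^ p)) (*-comm _ _) ⟩
    v ^ length p * g  ∎)

  num-≈0 : ∀ p → p ≈ₚ 0ₚ → num p ≈ 0#
  num-≈0 []      p≈0 = refl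
  num-≈0 (a ∷ p) p≈0 = begin
    φ a * (v * den p) + u * num p * 1#   ≈⟨ +-cong (*-congʳ (trans (φ.⟦⟧-cong (p≈0 0)) φ.0#-homo)) (*-congʳ (*-congˡ (num-≈0 p (λ k → p≈0 (suc k))))) ⟩
    0# * (v * den p) + u * 0# * 1#       ≈⟨ solve 3 (λ v d u → con 0ℚ :* (v :* d) :+ u :* con 0ℚ :* con 1ℚ := con 0ℚ) refl v (den p) u ⟩
    0#                                   ∎

  -- Trailing zeros lengthen `den`, so lists that agree as polynomials may yield different
  -- fractions. Only the cross-multiplied form is invariant.
  num-cong : ∀ p q → p ≈ₚ q → num p * den q ≈ num q * den p
  num-cong []      q       p≈q = trans (zeroˡ (den q)) (sym (trans (*-congʳ (num-≈0 q (λ k → ≡.sym (p≈q k)))) (zeroˡ 1#)))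
  num-cong (a ∷ p) []      p≈q = trans (*-congʳ (num-≈0 (a ∷ p) p≈q)) (trans (zeroˡ 1#) (sym (zeroˡ _)))
  num-cong (a ∷ p) (b ∷ q) p≈q = begin
    (φ a * (v * den p) + u * num p * 1#) * (1# * (v * den q))
      ≈⟨ solve 6 (λ a u v n d e → (a :* (v :* d) :+ u :* n :* con 1ℚ) :* (con 1ℚ :* (v :* e))
                                  := a :* v :* v :* d :* e :+ u :* v :* (n :* e)) refl (φ a) u v (num p) (den p) (den q) ⟩
    φ a * v * v * den p * den q + u * v * (num p * den q)
      ≈⟨ +-cong (*-congʳ (*-congʳ (*-congʳ (*-congʳ (φ.⟦⟧-cong (p≈q 0)))))) (*-congˡ (num-cong p q (λ k → p≈q (suc k)))) ⟩
    φ b * v * v * den p * den q + u * v * (num q * den p)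
      ≈⟨ solve 6 (λ a u v n d e → a :* v :* v :* d :* e :+ u :* v :* (n :* d)
                                  := (a :* (v :* e) :+ u :* n :* con 1ℚ) :* (con 1ℚ :* (v :* d))) refl (φ b) u v (num q) (den p) (den q) ⟩
    (φ b * (v * den q) + u * num q * 1#) * (1# * (v * den p)) ∎

  num-+ₚ : ∀ p q → num (p +ₚ q) * (den p * den q) ≈ (num p * den q + num q * den p) * den (p +ₚ q)
  num-+ₚ []      q       = solve 2 (λ n d → n :* (con 1ℚ :* d) := (con 0ℚ :* d :+ n :* con 1ℚ) :* d) refl (num q) (den q)
  num-+ₚ (a ∷ p) []      = solve 2 (λ n d → n :* (d :* con 1ℚ) := (n :* con 1ℚ :+ con 0ℚ :* d) :* d) refl (num (a ∷ p)) (den (a ∷ p))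
  num-+ₚ (a ∷ p) (b ∷ q) = begin
    (φ (a ℚ.+ b) * (v * r) + u * n * 1#) * ((1# * (v * d)) * (1# * (v * e)))
      ≈⟨ *-congʳ (+-congʳ (*-congʳ (φ.+-homo a b))) ⟩
    ((φ a + φ b) * (v * r) + u * n * 1#) * ((1# * (v * d)) * (1# * (v * e)))
      ≈⟨ solve 8 (λ a b u v n r d e → ((a :+ b) :* (v :* r) :+ u :* n :* con 1ℚ) :* ((con 1ℚ :* (v :* d)) :* (con 1ℚ :* (v :* e)))
                                      := (a :+ b) :* v :* v :* v :* r :* d :* e :+ u :* v :* v :* (n :* (d :* e)))
           refl (φ a) (φ b) u v n r d e ⟩
    (φ a + φ b) * v * v * v * r * d * e + u * v * v * (n * (d * e))
      ≈⟨ +-congˡ (*-congˡ (num-+ₚ p q)) ⟩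
    (φ a + φ b) * v * v * v * r * d * e + u * v * v * ((num p * e + num q * d) * r)
      ≈⟨ solve 9 (λ a b u v n m r d e → (a :+ b) :* v :* v :* v :* r :* d :* e :+ u :* v :* v :* ((n :* e :+ m :* d) :* r)
                   := ((a :* (v :* d) :+ u :* n :* con 1ℚ) :* (con 1ℚ :* (v :* e)) :+ (b :* (v :* e) :+ u :* m :* con 1ℚ) :* (con 1ℚ :* (v :* d))) :* (con 1ℚ :* (v :* r)))
           refl (φ a) (φ b) u v (num p) (num q) r d e ⟩
    (num (a ∷ p) * den (b ∷ q) + num (b ∷ q) * den (a ∷ p)) * (1# * (v * r)) ∎
    where
    n = num (p +ₚ q)
    r = den (p +ₚ q)
    d = den p
    e = den q

  den-scale : ∀ a p → den (map (a ℚ.*_) p) ≈ den p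
  den-scale a []      = refl
  den-scale a (b ∷ p) = *-congˡ (*-congˡ (den-scale a p))

  num-scale : ∀ a p → num (map (a ℚ.*_) p) ≈ φ a * num p
  num-scale a []      = sym (zeroʳ (φ a))
  num-scale a (b ∷ p) = begin
    φ (a ℚ.* b) * (v * den (map (a ℚ.*_) p)) + u * num (map (a ℚ.*_) p) * 1#
      ≈⟨ +-cong (*-cong (φ.*-homo a b) (*-congˡ (den-scale a p))) (*-congʳ (*-congˡ (num-scale a p))) ⟩
    φ a * φ b * (v * den p) + u * (φ a * num p) * 1#
      ≈⟨ solve 6 (λ a b v d u n → a :* b :* (v :* d) :+ u :* (a :* n) :* con 1ℚ := a :* (b :* (v :* d) :+ u :* n :* con 1ℚ))
           refl (φ a) (φ b) v (den p) u (num p) ⟩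
    φ a * num (b ∷ p) ∎

  Represents-congʳ : ∀ p m {h h′} → h ≈ h′ → Represents p m h → Represents p m h′
  Represents-congʳ p m h≈h′ rep = trans rep (*-congʳ h≈h′)

  Represents-congˡ : ∀ p q m {h} → p ≈ₚ q → Represents p m h → Represents q m h
  Represents-congˡ p q m {h} p≈q rep = den-cancel p _ _ (begin
    v ^ m * num q * den p    ≈⟨ *-assoc _ _ _ ⟩
    v ^ m * (num q * den p)  ≈⟨ *-congˡ (num-cong p q p≈q) ⟨
    v ^ m * (num p * den q)  ≈⟨ *-assoc _ _ _ ⟨
    v ^ m * num p * den q    ≈⟨ *-congʳ rep ⟩
    h * den p * den q        ≈⟨ trans (*-assoc _ _ _) (trans (*-congˡ (*-comm _ _)) (sym (*-assoc _ _ _))) ⟩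
    h * den q * den p        ∎)

  Represents-raise : ∀ p m h → Represents p m h → Represents p (suc m) (v * h)
  Represents-raise p m h rep = trans (*-assoc _ _ _) (trans (*-congˡ rep) (sym (*-assoc _ _ _)))

  Represents-lower : ∀ p m h → Represents p (suc m) (v * h) → Represents p m h
  Represents-lower p m h rep = v-cancel _ _ (trans (sym (*-assoc _ _ _)) (trans rep (*-assoc _ _ _)))

  Represents-+ : ∀ p q m h k → Represents p m h → Represents q m k → Represents (p +ₚ q) m (h + k)
  Represents-+ p q m h k rep-p rep-q = den-cancel q _ _ (den-cancel p _ _ (begin
    v ^ m * n * den q * den p
      ≈⟨ solve 4 (λ w n d e → w :* n :* e :* d := w :* (n :* (d :* e))) refl (v ^ m) n (den p) (den q) ⟩
    v ^ m * (n * (den p * den q))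
      ≈⟨ *-congˡ (num-+ₚ p q) ⟩
    v ^ m * ((num p * den q + num q * den p) * r)
      ≈⟨ solve 6 (λ w n m d e r → w :* ((n :* e :+ m :* d) :* r) := (w :* n :* e :+ w :* m :* d) :* r) refl (v ^ m) (num p) (num q) (den p) (den q) r ⟩
    (v ^ m * num p * den q + v ^ m * num q * den p) * r
      ≈⟨ *-congʳ (+-cong (*-congʳ rep-p) (*-congʳ rep-q)) ⟩
    (h * den p * den q + k * den q * den p) * r
      ≈⟨ solve 5 (λ h k d e r → (h :* d :* e :+ k :* e :* d) :* r := (h :+ k) :* r :* e :* d) refl h k (den p) (den q) r ⟩
    (h + k) * r * den q * den p ∎))
    where
    n = num (p +ₚ q)
    r = den (p +ₚ q)

  Represents-const* : ∀ a p m h → Represents p m h → Represents (const a *ₚ p) m (φ a * h)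
  Represents-const* a p m h rep = Represents-congˡ (map (a ℚ.*_) p) (const a *ₚ p) m (λ k → ≡.sym (const-*ₚ a p k)) (begin
    v ^ m * num (map (a ℚ.*_) p)      ≈⟨ *-congˡ (num-scale a p) ⟩
    v ^ m * (φ a * num p)             ≈⟨ solve 3 (λ w a n → w :* (a :* n) := a :* (w :* n)) refl (v ^ m) (φ a) (num p) ⟩
    φ a * (v ^ m * num p)             ≈⟨ *-congˡ rep ⟩
    φ a * (h * den p)                 ≈⟨ *-assoc _ _ _ ⟨
    φ a * h * den p                   ≈⟨ *-congˡ (den-scale a p) ⟨
    φ a * h * den (map (a ℚ.*_) p)    ∎)

  Represents-∷ : ∀ a p m h → Represents p m h → Represents (a ∷ p) (suc m) (φ a * v ^ suc m + u * h)
  Represents-∷ a p m h rep = begin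
    v * w * (φ a * (v * d) + u * num p * 1#)
      ≈⟨ solve 6 (λ v w a d u n → v :* w :* (a :* (v :* d) :+ u :* n :* con 1ℚ) := a :* v :* v :* w :* d :+ u :* v :* (w :* n)) refl v w (φ a) d u (num p) ⟩
    φ a * v * v * w * d + u * v * (w * num p)
      ≈⟨ +-congˡ (*-congˡ rep) ⟩
    φ a * v * v * w * d + u * v * (h * d)
      ≈⟨ solve 6 (λ v w a d u h → a :* v :* v :* w :* d :+ u :* v :* (h :* d) := (a :* (v :* w) :+ u :* h) :* (con 1ℚ :* (v :* d))) refl v w (φ a) d u h ⟩
    (φ a * (v * w) + u * h) * (1# * (v * d)) ∎
    where
    w = v ^ m
    d = den p

  Represents-0∷ : ∀ p m h → Represents p m h → Represents (0ℚ ∷ p) (suc m) (u * h)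
  Represents-0∷ p m h rep = Represents-congʳ (0ℚ ∷ p) (suc m)
    (trans (+-congʳ (trans (*-congʳ φ.0#-homo) (zeroˡ _))) (+-identityˡ _)) (Represents-∷ 0ℚ p m h rep)

  Represents-X* : ∀ p m h → Represents p m h → Represents (X *ₚ p) (suc m) (u * h)
  Represents-X* p m h rep = Represents-congˡ (0ℚ ∷ p) (X *ₚ p) (suc m) (λ k → ≡.sym (X-*ₚ p k)) (Represents-0∷ p m h rep)

  Represents-num : ∀ p → Represents p (length p) (num p)
  Represents-num p = trans (*-comm _ _) (*-congˡ (sym (den≈v^ p)))

  D-v : D v ≈ 1#
  D-v = trans (D-+ x 1#) (trans (+-cong D-x D-1#) (+-identityʳ 1#))

  D-u : D u ≈ 1#
  D-u = trans (D-+ x (- 1#)) (trans (+-cong D-x (trans (D-neg 1#) (-‿cong D-1#))) (solve 0 (con 1ℚ :- con 0ℚ := con 1ℚ) refl))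

  -- The factor `v` on the left avoids the exponent `m - 1`, so `m = 0` fits the same formula.
  v*D-v^ : ∀ m → v * D (v ^ m) ≈ φ (ν m) * v ^ m
  v*D-v^ zero    = trans (*-congˡ D-1#) (trans (zeroʳ v) (sym (trans (*-congʳ φ.0#-homo) (zeroˡ 1#))))
  v*D-v^ (suc m) = begin
    v * D (v * w)                        ≈⟨ *-congˡ (trans (leibniz v w) (+-congʳ (*-congʳ D-v))) ⟩
    v * (1# * w + v * D w)               ≈⟨ solve 3 (λ v w d → v :* (con 1ℚ :* w :+ v :* d) := v :* w :+ v :* (v :* d)) refl v w (D w) ⟩
    v * w + v * (v * D w)                ≈⟨ +-congˡ (*-congˡ (v*D-v^ m)) ⟩
    v * w + v * (φ (ν m) * w)            ≈⟨ solve 3 (λ v w n → v :* w :+ v :* (n :* w) := (con 1ℚ :+ n) :* (v :* w)) refl v w (φ (ν m)) ⟩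
    (1# + φ (ν m)) * (v * w)             ≈⟨ *-congʳ (φν-suc m) ⟨
    φ (ν (suc m)) * (v * w)              ∎
    where w = v ^ m

  -- (u / v)′ = 2 / v², so the chain rule turns h = v ^ m * p (u / v) into
  -- v * h′ = m h + 2 v ^ (m - 1) * p′ (u / v).
  chain : ℕ → Carrier → Carrier
  chain m h = φ ℚ.½ * (v * v * (v * D h - φ (ν m) * h))

  -- Recursion on the list settles the particular value `h = num p`, with exponent `length p`;
  -- `Represents-deriv` then extends this to every `h`.
  Represents-deriv-num : ∀ p → Represents (deriv p) (suc (length p)) (chain (length p) (num p))
  Represents-deriv-num []      = trans (zeroʳ _) (sym (trans (*-identityʳ _)
    (trans (*-congˡ (*-congˡ (+-congʳ (*-congˡ D-0#)))) (solve 3 (λ a v n → a :* (v :* v :* (v :* con 0ℚ :- n :* con 0ℚ)) := con 0ℚ) refl (φ ℚ.½) v (φ (ν 0))))))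
  Represents-deriv-num (a ∷ p) = Represents-congˡ (p +ₚ (0ℚ ∷ deriv p)) (deriv (a ∷ p)) (2 ℕ.+ l) (λ k → ≡.sym (deriv-∷ a p k))
    (Represents-congʳ (p +ₚ (0ℚ ∷ deriv p)) (2 ℕ.+ l) (sym chain-∷)
      (Represents-+ p (0ℚ ∷ deriv p) (2 ℕ.+ l) (v * (v * n)) (u * chain l n)
        (Represents-raise p (suc l) (v * n) (Represents-raise p l n (Represents-num p)))
        (Represents-0∷ (deriv p) (suc l) (chain l n) (Represents-deriv-num p))))
    where
    l = length p
    n = num p
    n′ = φ a * v ^ suc l + u * n

    num-∷ : num (a ∷ p) ≈ n′
    num-∷ = +-cong (*-congˡ (*-congˡ (den≈v^ p))) (*-identityʳ _)

    v*D-n′ : v * D n′ ≈ φ a * ((1# + φ (ν l)) * v ^ suc l) + v * (n + u * D n)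
    v*D-n′ = begin
      v * D n′
        ≈⟨ *-congˡ (trans (D-+ _ _) (+-cong (D-scale a (v ^ suc l)) (trans (leibniz u n) (+-congʳ (trans (*-congʳ D-u) (*-identityˡ n)))))) ⟩
      v * (φ a * D (v ^ suc l) + (n + u * D n))
        ≈⟨ solve 4 (λ v a d r → v :* (a :* d :+ r) := a :* (v :* d) :+ v :* r) refl v (φ a) (D (v ^ suc l)) (n + u * D n) ⟩
      φ a * (v * D (v ^ suc l)) + v * (n + u * D n)
        ≈⟨ +-congʳ (*-congˡ (trans (v*D-v^ (suc l)) (*-congʳ (φν-suc l)))) ⟩
      φ a * ((1# + φ (ν l)) * v ^ suc l) + v * (n + u * D n) ∎

    chain-∷ : chain (suc l) (num (a ∷ p)) ≈ v * (v * n) + u * chain l n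
    chain-∷ = begin
      φ ℚ.½ * (v * v * (v * D (num (a ∷ p)) - φ (ν (suc l)) * num (a ∷ p)))
        ≈⟨ *-congˡ (*-congˡ (+-cong (trans (*-congˡ (D-cong num-∷)) v*D-n′) (-‿cong (*-cong (φν-suc l) num-∷)))) ⟩
      φ ℚ.½ * (v * v * (φ a * ((1# + φ (ν l)) * v ^ suc l) + v * (n + u * D n) - (1# + φ (ν l)) * n′))
        -- `u` and `v` are expanded in `x` because the identity uses `v - u = 2`, which cancels the
        -- factor ½.
        ≈⟨ solve 6 (λ x a s w n d → let v = x :+ con 1ℚ ; u = x :+ :- con 1ℚ in
             con ℚ.½ :* (v :* v :* (a :* ((con 1ℚ :+ s) :* w) :+ v :* (n :+ u :* d) :- (con 1ℚ :+ s) :* (a :* w :+ u :* n)))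
             := v :* (v :* n) :+ u :* (con ℚ.½ :* (v :* v :* (v :* d :- s :* n))))
             refl x (φ a) (φ (ν l)) (v ^ suc l) n (D n) ⟩
      v * (v * n) + u * chain l n ∎

  -- Two representatives of the same value satisfy `M * n ≈ V * h`. Differentiating this relation
  -- shows that `chain` respects it, and the power `V` is cancelled at the end.
  Represents-deriv : ∀ p m h → Represents p m h → Represents (deriv p) (suc m) (chain m h)
  Represents-deriv p m h rep = v^-cancel l _ _ (begin
    V * (v * M * num (deriv p))
      ≈⟨ solve 4 (λ V v M n → V :* (v :* M :* n) := M :* (v :* V :* n)) refl V v M (num (deriv p)) ⟩
    M * (v * V * num (deriv p))
      ≈⟨ *-congˡ (Represents-deriv-num p) ⟩
    M * (chain l n * den (deriv p))
      ≈⟨ *-assoc _ _ _ ⟨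
    M * chain l n * den (deriv p)
      ≈⟨ *-congʳ chains ⟩
    V * chain m h * den (deriv p)
      ≈⟨ *-assoc _ _ _ ⟩
    V * (chain m h * den (deriv p)) ∎)
    where
    l = length p
    n = num p
    M = v ^ m
    V = v ^ l

    M*n≈V*h : M * n ≈ V * h
    M*n≈V*h = trans rep (trans (*-congˡ (den≈v^ p)) (*-comm h V))

    v*D-v^* : ∀ m f → v * D (v ^ m * f) ≈ φ (ν m) * (v ^ m * f) + v * v ^ m * D f
    v*D-v^* m f = begin
      v * D (v ^ m * f)                              ≈⟨ *-congˡ (leibniz (v ^ m) f) ⟩
      v * (D (v ^ m) * f + v ^ m * D f)              ≈⟨ solve 5 (λ v d f w e → v :* (d :* f :+ w :* e) := v :* d :* f :+ v :* w :* e) refl v (D (v ^ m)) f (v ^ m) (D f) ⟩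
      v * D (v ^ m) * f + v * v ^ m * D f            ≈⟨ +-congʳ (trans (*-congʳ (v*D-v^ m)) (*-assoc _ _ _)) ⟩
      φ (ν m) * (v ^ m * f) + v * v ^ m * D f        ∎

    differentiated : φ (ν m) * (V * h) + v * M * D n ≈ φ (ν l) * (M * n) + v * V * D h
    differentiated = begin
      φ (ν m) * (V * h) + v * M * D n  ≈⟨ +-congʳ (*-congˡ M*n≈V*h) ⟨
      φ (ν m) * (M * n) + v * M * D n  ≈⟨ v*D-v^* m n ⟨
      v * D (M * n)                    ≈⟨ *-congˡ (D-cong M*n≈V*h) ⟩
      v * D (V * h)                    ≈⟨ v*D-v^* l h ⟩
      φ (ν l) * (V * h) + v * V * D h  ≈⟨ +-congʳ (*-congˡ M*n≈V*h) ⟨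
      φ (ν l) * (M * n) + v * V * D h  ∎

    chains : M * chain l n ≈ V * chain m h
    chains = begin
      M * chain l n
        -- The term `φ (ν m) * (V * h)` is added and subtracted to expose the left-hand side of
        -- `differentiated`.
        ≈⟨ solve 8 (λ a v M d s n t vh → M :* (a :* (v :* v :* (v :* d :- s :* n)))
                      := a :* (v :* v :* (t :* vh :+ v :* M :* d :- (s :* (M :* n) :+ t :* vh)))) refl (φ ℚ.½) v M (D n) (φ (ν l)) n (φ (ν m)) (V * h) ⟩
      φ ℚ.½ * (v * v * (φ (ν m) * (V * h) + v * M * D n - (φ (ν l) * (M * n) + φ (ν m) * (V * h))))
        ≈⟨ *-congˡ (*-congˡ (+-congʳ differentiated)) ⟩
      φ ℚ.½ * (v * v * (φ (ν l) * (M * n) + v * V * D h - (φ (ν l) * (M * n) + φ (ν m) * (V * h))))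
        ≈⟨ solve 7 (λ a v y V d t h → a :* (v :* v :* (y :+ v :* V :* d :- (y :+ t :* (V :* h))))
                      := V :* (a :* (v :* v :* (v :* d :- t :* h)))) refl (φ ℚ.½) v (φ (ν l) * (M * n)) V (D h) (φ (ν m)) h ⟩
      V * chain m h ∎

  T-operator : ℚ → ℚ → Poly → Poly
  T-operator c ε p = (const c *ₚ X ^ₚ 2 +ₚ X +ₚ 1ₚ +ₚ const c) *ₚ p
    +ₚ const ε *ₚ (-ₚ (X ^ₚ 3) +ₚ X ^ₚ 2 +ₚ -ₚ X +ₚ 1ₚ) *ₚ deriv p

  -- With `ε = 1 / δ` this is `2 / δ` times the right-hand side of the recurrence of `Q`.
  reduced-step : ℚ → Carrier → Carrier
  reduced-step ε h = φ (ν 2) * x * h + φ (ν 2) * φ ε * (1# + x ^ 2) * D h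

  -- With `y = u / v`, `- y³ + y² - y + 1 = (1 - y)(1 + y²)` and `1 - y = 2 / v`, so the part
  -- `- n h` of the chain rule cancels against `c (1 + y²)` for `c = ε n`. All terms are raised to
  -- exponent `n + 4`, that of `X³p′`, and three factors `v` are cancelled afterwards.
  Represents-T-operator : ∀ ε n p h → Represents p n h →
    Represents (T-operator (ε ℚ.* ν n) ε p) (suc n) (reduced-step ε h)
  Represents-T-operator ε n p h rep =
    lower 1 (lower 2 (lower 3 (Represents-congʳ S (4 ℕ.+ n) simplify
      (Represents-congˡ (a +ₚ b) S (4 ℕ.+ n)
        (λ i → ≡.sym (Identities.T-step-expand polyAlgebra (const c) (const ε) X p p′ i))
        (add a b rep-a (scale ε b′ rep-b′))))))
    where
    c = ε ℚ.* ν n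
    p′ = deriv p
    k = chain n h
    S = T-operator c ε p
    rep′ = Represents-deriv p n h rep

    X²p X²p′ X³p′ a b b′ : Poly
    X²p  = X *ₚ (X *ₚ p)
    X²p′ = X *ₚ (X *ₚ p′)
    X³p′ = X *ₚ X²p′
    a    = const c *ₚ X²p +ₚ X *ₚ p +ₚ p +ₚ const c *ₚ p
    b′   = const (ℚ.- 1ℚ) *ₚ X³p′ +ₚ X²p′ +ₚ const (ℚ.- 1ℚ) *ₚ (X *ₚ p′) +ₚ p′
    b    = const ε *ₚ b′

    raise : ∀ j p {h} → Represents p (j ℕ.+ n) h → Represents p (suc j ℕ.+ n) (v * h)
    raise j p {h} = Represents-raise p (j ℕ.+ n) h

    raise⁴ : Represents p (4 ℕ.+ n) (v * (v * (v * (v * h))))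
    raise⁴ = raise 3 p (raise 2 p (raise 1 p (raise 0 p rep)))

    X* : ∀ j p {h} → Represents p (j ℕ.+ n) h → Represents (X *ₚ p) (suc j ℕ.+ n) (u * h)
    X* j p {h} = Represents-X* p (j ℕ.+ n) h

    lower : ∀ j {h} → Represents S (suc j ℕ.+ n) (v * h) → Represents S (j ℕ.+ n) h
    lower j {h} = Represents-lower S (j ℕ.+ n) h

    add : ∀ p q {h k} → Represents p (4 ℕ.+ n) h → Represents q (4 ℕ.+ n) k → Represents (p +ₚ q) (4 ℕ.+ n) (h + k)
    add p q {h} {k} = Represents-+ p q (4 ℕ.+ n) h k

    scale : ∀ a p {h} → Represents p (4 ℕ.+ n) h → Represents (const a *ₚ p) (4 ℕ.+ n) (φ a * h)
    scale a p {h} = Represents-const* a p (4 ℕ.+ n) h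

    rep-a : Represents a (4 ℕ.+ n) _
    rep-a = add (const c *ₚ X²p +ₚ X *ₚ p +ₚ p) (const c *ₚ p)
      (add (const c *ₚ X²p +ₚ X *ₚ p) p
        (add (const c *ₚ X²p) (X *ₚ p)
          (scale c X²p (raise 3 X²p (raise 2 X²p (X* 1 (X *ₚ p) (X* 0 p rep)))))
          (raise 3 (X *ₚ p) (raise 2 (X *ₚ p) (raise 1 (X *ₚ p) (X* 0 p rep)))))
        raise⁴)
      (scale c p raise⁴)

    rep-b′ : Represents b′ (4 ℕ.+ n) _
    rep-b′ = add (const (ℚ.- 1ℚ) *ₚ X³p′ +ₚ X²p′ +ₚ const (ℚ.- 1ℚ) *ₚ (X *ₚ p′)) p′
      (add (const (ℚ.- 1ℚ) *ₚ X³p′ +ₚ X²p′) (const (ℚ.- 1ℚ) *ₚ (X *ₚ p′))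
        (add (const (ℚ.- 1ℚ) *ₚ X³p′) X²p′
          (scale (ℚ.- 1ℚ) X³p′ (X* 3 X²p′ (X* 2 (X *ₚ p′) (X* 1 p′ rep′))))
          (raise 3 X²p′ (X* 2 (X *ₚ p′) (X* 1 p′ rep′))))
        (scale (ℚ.- 1ℚ) (X *ₚ p′) (raise 3 (X *ₚ p′) (raise 2 (X *ₚ p′) (X* 1 p′ rep′)))))
      (raise 3 p′ (raise 2 p′ (raise 1 p′ rep′)))

    simplify : φ c * (v * (v * (u * (u * h)))) + v * (v * (v * (u * h))) + v * (v * (v * (v * h))) + φ c * (v * (v * (v * (v * h))))
      + φ ε * (φ (ℚ.- 1ℚ) * (u * (u * (u * k))) + v * (u * (u * k)) + φ (ℚ.- 1ℚ) * (v * (v * (u * k))) + v * (v * (v * k)))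
      ≈ v * (v * (v * reduced-step ε h))
    simplify = trans
      (+-congʳ (+-cong (+-congʳ (+-congʳ (*-congʳ (φ.*-homo ε (ν n))))) (*-congʳ (φ.*-homo ε (ν n)))))
      (solve 5 (λ x e s h d →
        let v = x :+ con 1ℚ ; u = x :+ :- con 1ℚ ; k = con ℚ.½ :* (v :* v :* (v :* d :- s :* h)) in
        e :* s :* (v :* (v :* (u :* (u :* h)))) :+ v :* (v :* (v :* (u :* h))) :+ v :* (v :* (v :* (v :* h))) :+ e :* s :* (v :* (v :* (v :* (v :* h))))
        :+ e :* (con (ℚ.- 1ℚ) :* (u :* (u :* (u :* k))) :+ v :* (u :* (u :* k)) :+ con (ℚ.- 1ℚ) :* (v :* (v :* (u :* k))) :+ v :* (v :* (v :* k)))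
        := v :* (v :* (v :* (con (ν 2) :* x :* h :+ con (ν 2) :* e :* (con 1ℚ :+ x :^ 2) :* d))))
        refl x (φ ε) (φ (ν n)) h (D h))

  reduced : ℚ → ℕ → Carrier
  reduced ε zero    = 1#
  reduced ε (suc n) = reduced-step ε (reduced ε n)

  Represents-reduced : ∀ ε (T : ℕ → Poly) → T 0 ≈ₚ 1ₚ → (∀ n → T (suc n) ≈ₚ T-operator (ε ℚ.* ν n) ε (T n)) →
    ∀ n → Represents (T n) n (reduced ε n)
  Represents-reduced ε T T-zero T-suc zero    = Represents-congˡ 1ₚ (T 0) 0 (λ k → ≡.sym (T-zero k))
    (*-congˡ (trans (+-congʳ (*-congʳ φ.1#-homo)) (solve 2 (λ u v → con 1ℚ :* (v :* con 1ℚ) :+ u :* con 0ℚ :* con 1ℚ := con 1ℚ :* (v :* con 1ℚ)) refl u v)))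
  Represents-reduced ε T T-zero T-suc (suc n) = Represents-congˡ (T-operator (ε ℚ.* ν n) ε (T n)) (T (suc n)) (suc n)
    (λ k → ≡.sym (T-suc n k)) (Represents-T-operator ε n (T n) (reduced ε n) (Represents-reduced ε T T-zero T-suc n))

  -- Each step trades a factor 2 for a factor `δ`, and `δ ε = 1` removes `ε` from the derivative
  -- term. The intended `κ n` is `(δ / 2) ^ n`.
  reduced-scale : ∀ δ ε (κ : ℕ → ℚ) (q : ℕ → Carrier) →
    δ ℚ.* ε ≡ 1ℚ → κ 0 ≡ 1ℚ → (∀ n → κ (suc n) ℚ.* ν 2 ≡ κ n ℚ.* δ) →
    q 0 ≈ 1# → (∀ n → q (suc n) ≈ φ δ * x * q n + (1# + x ^ 2) * D (q n)) →
    ∀ n → φ (κ n) * reduced ε n ≈ q n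
  reduced-scale δ ε κ q δε≡1 κ-zero κ-suc q-zero q-suc zero    =
    trans (*-identityʳ _) (trans (trans (φ.⟦⟧-cong κ-zero) φ.1#-homo) (sym q-zero))
  reduced-scale δ ε κ q δε≡1 κ-zero κ-suc q-zero q-suc (suc n) = begin
    φ (κ (suc n)) * (φ (ν 2) * x * h + φ (ν 2) * φ ε * (1# + x ^ 2) * D h)
      ≈⟨ *-congˡ (+-congˡ (*-assoc _ _ _)) ⟩
    φ (κ (suc n)) * (φ (ν 2) * x * h + φ (ν 2) * φ ε * ((1# + x ^ 2) * D h))
      ≈⟨ solve 6 (λ k t x h e y → k :* (t :* x :* h :+ t :* e :* y) := k :* t :* x :* h :+ k :* t :* e :* y)
           refl (φ (κ (suc n))) (φ (ν 2)) x h (φ ε) ((1# + x ^ 2) * D h) ⟩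
    φ (κ (suc n)) * φ (ν 2) * x * h + φ (κ (suc n)) * φ (ν 2) * φ ε * ((1# + x ^ 2) * D h)
      ≈⟨ +-cong (*-congʳ (*-congʳ κ-step)) (*-congʳ κε-step) ⟩
    φ δ * φ (κ n) * x * h + φ (κ n) * ((1# + x ^ 2) * D h)
      ≈⟨ solve 6 (λ d k x h w y → d :* k :* x :* h :+ k :* (w :* y) := d :* x :* (k :* h) :+ w :* (k :* y))
           refl (φ δ) (φ (κ n)) x h (1# + x ^ 2) (D h) ⟩
    φ δ * x * (φ (κ n) * h) + (1# + x ^ 2) * (φ (κ n) * D h)
      ≈⟨ +-cong (*-congˡ ih) (*-congˡ (trans (sym (D-scale (κ n) h)) (D-cong ih))) ⟩
    φ δ * x * q n + (1# + x ^ 2) * D (q n)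
      ≈⟨ q-suc n ⟨
    q (suc n) ∎
    where
    h = reduced ε n
    ih = reduced-scale δ ε κ q δε≡1 κ-zero κ-suc q-zero q-suc n

    κ-step : φ (κ (suc n)) * φ (ν 2) ≈ φ δ * φ (κ n)
    κ-step = trans (sym (φ.*-homo _ _)) (trans (φ.⟦⟧-cong (κ-suc n)) (trans (φ.*-homo _ _) (*-comm _ _)))

    κε-step : φ (κ (suc n)) * φ (ν 2) * φ ε ≈ φ (κ n)
    κε-step = begin
      φ (κ (suc n)) * φ (ν 2) * φ ε  ≈⟨ *-congʳ κ-step ⟩
      φ δ * φ (κ n) * φ ε            ≈⟨ solve 3 (λ d k e → d :* k :* e := d :* e :* k) refl (φ δ) (φ (κ n)) (φ ε) ⟩
      φ δ * φ ε * φ (κ n)            ≈⟨ *-congʳ (trans (sym (φ.*-homo δ ε)) (trans (φ.⟦⟧-cong δε≡1) φ.1#-homo)) ⟩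
      1# * φ (κ n)                   ≈⟨ *-identityˡ _ ⟩
      φ (κ n)                        ∎

  -- The factors `1#` are denominators of embedded polynomials; keeping them makes the conclusion
  -- the literal unfolding of `_≈ᵣ_`.
  Represents⇒fraction : ∀ k p m h q → φ k * h ≈ q → Represents p m h →
    q * (1# * den p) ≈ φ k * (1# + x) ^ m * num p * 1#
  Represents⇒fraction k p m h q kh≈q rep = begin
    q * (1# * den p)                   ≈⟨ *-cong (sym kh≈q) (*-identityˡ _) ⟩
    φ k * h * den p                    ≈⟨ *-assoc _ _ _ ⟩
    φ k * (h * den p)                  ≈⟨ *-congˡ rep ⟨
    φ k * (v ^ m * num p)              ≈⟨ *-congˡ (*-congʳ (^-congˡ m (+-comm x 1#))) ⟩
    φ k * ((1# + x) ^ m * num p)       ≈⟨ trans (sym (*-assoc _ _ _)) (sym (*-identityʳ _)) ⟩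
    φ k * (1# + x) ^ m * num p * 1#    ∎
    where open import Algebra.Properties.Semiring.Exp semiring using (^-congˡ)

-- The three identities in ℚ[x].

private
  module Sub = Substitution polyDifferential X+1-cancel
  module DP = DerivativePolynomials polyDifferential

num-eval : ∀ p → RatFun.num (eval p [x-1]/[x+1]) ≡ Sub.num p
den-eval : ∀ p → RatFun.den (eval p [x-1]/[x+1]) ≡ Sub.den p
num-eval []      = ≡.refl
num-eval (a ∷ p) = ≡.cong₂ (λ d n → const a *ₚ ((X +ₚ 1ₚ) *ₚ d) +ₚ (X +ₚ -ₚ 1ₚ) *ₚ n *ₚ 1ₚ) (den-eval p) (num-eval p)
den-eval []      = ≡.refl
den-eval (a ∷ p) = ≡.cong (λ d → 1ₚ *ₚ ((X +ₚ 1ₚ) *ₚ d)) (den-eval p)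

n+[1+d]∸1≡n+d : ∀ n d → (n ℕ.+ suc d) ℕ.∸ 1 ≡ n ℕ.+ d
n+[1+d]∸1≡n+d n d = ≡.cong (ℕ._∸ 1) (ℕ.+-suc n d)

Q≈T : ∀ d (T : ℕ → Poly) → IsT (suc d) T → ∀ n →
  ι (Q (suc d) n) ≈ᵣ ι (const (((+ (suc d ℕ.^ n)) / (2 ℕ.^ n)) {{ℕ.m^n≢0 2 n}}) *ₚ (1ₚ +ₚ X) ^ₚ n)
                       *ᵣ eval (T ((n ℕ.+ suc d) ℕ.∸ 1)) [x-1]/[x+1]
Q≈T d T isT n = ≡.subst (λ i → ι (Q δ n) ≈ᵣ ι (const (κ n) *ₚ (1ₚ +ₚ X) ^ₚ n) *ᵣ eval (T i) [x-1]/[x+1])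
  (≡.sym (n+[1+d]∸1≡n+d n d))
  (≡.subst₂ (λ N D → Q δ n *ₚ (1ₚ *ₚ D) ≈ₚ const (κ n) *ₚ (1ₚ +ₚ X) ^ₚ n *ₚ N *ₚ 1ₚ)
    (≡.sym (num-eval (T (n ℕ.+ d)))) (≡.sym (den-eval (T (n ℕ.+ d))))
    (Sub.Represents⇒fraction (κ n) (T (n ℕ.+ d)) n (Sub.reduced ε n) (Q δ n)
      (Sub.reduced-scale (ν δ) ε κ (Q δ) (ν-inverse d) ≡.refl κ-suc (λ _ → ≡.refl) (λ _ _ → ≡.refl) n)
      -- Shifting the index by `d = δ - 1` makes the sequence start at 0, as `reduced` does.
      (Sub.Represents-reduced ε (λ n → T (n ℕ.+ d)) (IsT.base isT) T-suc n)))
  where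
  δ = suc d
  ε = + 1 / δ

  κ : ℕ → ℚ
  κ n = ((+ (δ ℕ.^ n)) / (2 ℕ.^ n)) {{ℕ.m^n≢0 2 n}}

  κ-suc : ∀ n → κ (suc n) ℚ.* ν 2 ≡ κ n ℚ.* ν δ
  κ-suc n = ≡.trans
    (+/-*-/ (δ ℕ.^ suc n) 2 (δ ℕ.^ suc n) (2 ℕ.^ suc n) 1 (2 ℕ.^ n) {{ℕ.m^n≢0 2 (suc n)}} {{_}} {{ℕ.m^n≢0 2 n}} (eq₁ (δ ℕ.^ suc n) (2 ℕ.^ n)))
    (≡.sym (+/-*-/ (δ ℕ.^ n) δ (δ ℕ.^ suc n) (2 ℕ.^ n) 1 (2 ℕ.^ n) {{ℕ.m^n≢0 2 n}} {{_}} {{ℕ.m^n≢0 2 n}} (eq₂ δ (δ ℕ.^ n) (2 ℕ.^ n))))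
    where
    eq₁ : ∀ a b → a ℕ.* 2 ℕ.* b ≡ a ℕ.* (2 ℕ.* b ℕ.* 1)
    eq₁ = solve-∀
    eq₂ : ∀ δ a b → a ℕ.* δ ℕ.* b ≡ δ ℕ.* a ℕ.* (b ℕ.* 1)
    eq₂ = solve-∀

  c≡ε*ν : ∀ n → IsT.c isT (n ℕ.+ d) ≡ ε ℚ.* ν n
  c≡ε*ν n = ≡.trans (≡.cong (_/ δ) (eq₁ (+ n) (+ d))) (≡.sym (+/-*-/ 1 n n δ 1 δ (eq₂ n δ)))
    where
    eq₁ : ∀ n d → (n ℤ.+ d) ℤ.- (+ 1 ℤ.+ d) ℤ.+ + 1 ≡ n
    eq₁ = ℤ-Solver.solve-∀
    eq₂ : ∀ n δ → 1 ℕ.* n ℕ.* δ ≡ n ℕ.* (δ ℕ.* 1)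
    eq₂ = solve-∀

  T-suc : ∀ n → T (suc n ℕ.+ d) ≈ₚ Sub.T-operator (ε ℚ.* ν n) ε (T (n ℕ.+ d))
  T-suc n = ≡.subst (λ c → T (suc n ℕ.+ d) ≈ₚ Sub.T-operator c ε (T (n ℕ.+ d))) (c≡ε*ν n)
    (IsT.step isT (n ℕ.+ d) (ℕ.m≤n+m d n))

open import Data.Nat.Base using (_+_; _*_; _∸_; _^_)
open import Data.Nat.Properties using (m^n≢0)
open PowerSeries ℚ[x]

proposition4p10 : (δ : ℕ) .{{_ : NonZero δ}} (T : ℕ → Poly) → IsT δ T →
    (∀ n → ι (Q δ n)
    ≈ᵣ ι (const (((+ (δ ^ n)) / (2 ^ n)) {{m^n≢0 2 n}}) *ₚ (1ₚ +ₚ X) ^ₚ n)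
    *ᵣ eval (T ((n + δ) ∸ 1)) [x-1]/[x+1])
    × (egf (Q δ) ≈ₛ recip ((cos-t -ₛ C X *ₛ sin-t) ^ₛ δ))
    × IsJFraction (ogf (Q δ))
    (λ i → const ((+ (2 * i + δ)) / 1) *ₚ X)
    (λ i → const ((+ (i * ((i + δ) ∸ 1))) / 1) *ₚ (1ₚ +ₚ X ^ₚ 2))
proposition4p10 δ@(suc d) T isT =
    Q≈T d T isT
  , DP.qₑ≈recip δ (Q δ) (λ _ → ≡.refl) (λ _ _ → ≡.refl)
  -- The convergent with `k` levels is exact in the coefficients below `k`, so coefficient `n` is
  -- settled from `suc n` on; `suc n ≤ k` is literally `n < k`.
  , λ n → suc n , λ k n<k → DP.q-jfraction δ (Q δ) (λ _ → ≡.refl) (λ _ _ → ≡.refl) _ (λ _ _ → ≡.refl) k n<k
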